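{- Let $G$ be a connected graph of order at least 3. Then $G$ is a minimal DPDP-graph if and only if $G=S_2(H)$ for some connected graph $H$ (and some function $\alpha$), and either $(V^o_{S_2(H)},V^n_{S_2(H)})$ is the only DP-pair in $S_2(H)$, or $S_2(H)$ is a cycle of length 3, 6 or 9.
   Context: Graphs are finite and may have multiple edges and loops. A leaf is a vertex of degree one. A set $D\subseteq V(G)$ is dominating if every vertex outside $D$ has a neighbor in $D$; $P$ is paired-dominating if it is dominating and the subgraph induced by $P$ has a perfect matching. A DP-pair of $G$ is a pair $(D,P)$ of disjoint sets with $V(G)=D\cup P$, $D$ dominating and $P$ paired-dominating. A DPDP-graph is a graph with a DP-pair; a minimal DPDP-graph is a DPDP-graph no proper spanning subgraph of which is a DPDP-graph. 2-subdivision graph: for a graph $H$ with no isolated vertex, set of leaves $L_H$, and $\alpha:L_H\to\mathbb{N}=\{1,2,\dots\}$, $S_2(H)$ has vertex set $V^o_{S_2(H)}\cup V^n_{S_2(H)}$ where $V^o_{S_2(H)}=(V_H\setminus L_H)\cup\{(v,i): v\in L_H, 1\le i\le \alpha(v)\}$ and $V^n_{S_2(H)}$ consists of two new vertices for each edge $e$ of $H$ ($u_e,v_e$ if $e$ joins $u\ne v$; $v_e^1,v_e^2$ if $e$ is a loop at $v$). Its edges are: the edge joining the two new vertices of each $e$; for $v\in V_H\setminus L_H$, $vv_e$ for each non-loop edge $e$ at $v$ and $vv_e^1,vv_e^2$ for each loop $e$ at $v$; for $v\in L_H$ with incident edge $e$, the edges $v_e(v,i)$, $1\le i\le\alpha(v)$.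 -}

module Defs where

open import Data.Bool using (Bool; true; false; not; T)
open import Data.Fin using (Fin; zero; suc; toℕ)
open import Data.Fin.Properties using (0↔⊥; 1↔⊤; 2↔Bool; +↔⊎; inj⇒≟)
open import Data.List using (List; []; _∷_; map; filter; length; allFin; cartesianProduct)
open import Data.Nat as ℕ using (ℕ; zero; suc; _≤_; NonZero)
open import Data.Nat.DivMod using (_mod_)
open import Data.Product using (Σ; Σ-syntax; ∃-syntax; ∃!; _×_; _,_)
open import Data.Product.Function.Dependent.Propositional using (Σ-↔)
open import Data.Sum using (_⊎_; inj₁; inj₂)
open import Data.Sum.Function.Propositional using (_⊎-↔_)
open import Function using (_∘_)
open import Function.Bundles using (_↔_; Inverse; mk↔ₛ′)
open import Function.Properties.Inverse using (↔-refl; ↔-sym; ↔-trans; ↔⇒↣)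
open import Relation.Binary.Construct.Closure.ReflexiveTransitive using (Star)
open import Relation.Binary.Definitions using (DecidableEquality)
open import Relation.Binary.PropositionalEquality using (_≡_; _≗_; refl)
open import Relation.Nullary using (¬_)
open import Relation.Nullary.Decidable using (True; False)

record Finite (A : Set) : Set where
  constructor finite
  field
    card : ℕ
    enum : A ↔ Fin card

  elements : List A
  elements = map (Inverse.from enum) (allFin card)

  _≟_ : DecidableEquality A
  _≟_ = inj⇒≟ (↔⇒↣ enum)

transport-finite : {A B : Set} → A ↔ B → Finite B → Finite A
transport-finite i (finite n e) = finite n (↔-trans i e)

Fin-finite : (n : ℕ) → Finite (Fin n)
Fin-finite n = finite n ↔-refl

Bool-finite : Finite Bool
Bool-finite = finite 2 (↔-sym 2↔Bool)

T-finite : (b : Bool) → Finite (T b)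
T-finite false = finite 0 (↔-sym 0↔⊥)
T-finite true  = finite 1 (↔-sym 1↔⊤)

⊎-finite : {A B : Set} → Finite A → Finite B → Finite (A ⊎ B)
⊎-finite (finite m e) (finite n f) = finite (m ℕ.+ n) (↔-trans (e ⊎-↔ f) (↔-sym +↔⊎))

ΣFin-split : {n : ℕ} {B : Fin (suc n) → Set} → Σ (Fin (suc n)) B ↔ (B zero ⊎ Σ (Fin n) (B ∘ suc))
ΣFin-split = mk↔ₛ′
  (λ { (zero , b) → inj₁ b ; (suc i , b) → inj₂ (i , b) })
  (λ { (inj₁ b) → zero , b ; (inj₂ (i , b)) → suc i , b })
  (λ { (inj₁ b) → refl ; (inj₂ (i , b)) → refl })
  (λ { (zero , b) → refl ; (suc i , b) → refl })

ΣFin-finite : (n : ℕ) {B : Fin n → Set} → (∀ i → Finite (B i)) → Finite (Σ (Fin n) B)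
ΣFin-finite zero    f = finite 0 (mk↔ₛ′ (λ ()) (λ ()) (λ ()) (λ ()))
ΣFin-finite (suc n) f = transport-finite ΣFin-split (⊎-finite (f zero) (ΣFin-finite n (f ∘ suc)))

Σ-finite : {A : Set} {B : A → Set} → Finite A → (∀ a → Finite (B a)) → Finite (Σ A B)
Σ-finite (finite n e) f =
  transport-finite (↔-sym (Σ-↔ (↔-sym e) ↔-refl)) (ΣFin-finite n (f ∘ Inverse.from e))

Subset : Set → Set
Subset A = A → Bool

infix 4 _∈_ _∉_

_∈_ _∉_ : {A : Set} → A → Subset A → Set
x ∈ S = T (S x)
x ∉ S = ¬ (x ∈ S)

-- Finite graphs with multiple edges and loops allowed.  The two ends of an
-- edge e are endpoint e false and endpoint e true; which of them is called
-- false carries no meaning (see _≅_).  A pair (e , s) is a half-edge.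
record Graph : Set₁ where
  field
    V E      : Set
    V-finite : Finite V
    E-finite : Finite E
    endpoint : E → Bool → V

  order : ℕ
  order = Finite.card V-finite

  Incident : E → V → Set
  Incident e v = ∃[ s ] endpoint e s ≡ v

  Loop : E → Set
  Loop e = endpoint e false ≡ endpoint e true

  Adjacent : V → V → Set
  Adjacent u v = ∃[ e ] ∃[ s ] (endpoint e s ≡ u × endpoint e (not s) ≡ v)

  -- The number of half-edges at v, so that a loop contributes two.
  degree : V → ℕ
  degree v = length (filter (λ { (e , s) → Finite._≟_ V-finite (endpoint e s) v })
                            (cartesianProduct (Finite.elements E-finite) (false ∷ true ∷ [])))

  -- Proof-irrelevant (each is ⊤ or ⊥), so they carve out subtypes of V.
  Leaf NonLeaf : V → Set
  Leaf    v = True  (degree v ℕ.≟ 1)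
  NonLeaf v = False (degree v ℕ.≟ 1)

  NoIsolatedVertex : Set
  NoIsolatedVertex = ∀ v → 1 ≤ degree v

  Connected : Set
  Connected = 1 ≤ order × (∀ u v → Star Adjacent u v)

  Dominating : Subset V → Set
  Dominating D = ∀ v → v ∉ D → ∃[ u ] (u ∈ D × Adjacent v u)

  -- M is a perfect matching of the subgraph of the graph induced by P: its edges
  -- have both ends in P, and each vertex of P is in exactly one of them.
  IsPerfectMatchingOf : Subset V → Subset E → Set
  IsPerfectMatchingOf P M =
      (∀ e → e ∈ M → (∀ s → endpoint e s ∈ P) × ¬ Loop e)
    × (∀ v → v ∈ P → ∃! _≡_ (λ e → e ∈ M × Incident e v))

  PairedDominating : Subset V → Set
  PairedDominating P = Dominating P × ∃[ M ] IsPerfectMatchingOf P M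

  record IsDPPair (D P : Subset V) : Set where
    field
      disjoint         : ∀ v → ¬ (v ∈ D × v ∈ P)
      covers           : ∀ v → v ∈ D ⊎ v ∈ P
      dominating       : Dominating D
      pairedDominating : PairedDominating P

  IsOnlyDPPair : Subset V → Subset V → Set
  IsOnlyDPPair D P = IsDPPair D P × (∀ D′ P′ → IsDPPair D′ P′ → D′ ≗ D × P′ ≗ P)

  IsDPDP : Set
  IsDPDP = ∃[ D ] ∃[ P ] IsDPPair D P

open Graph

spanningSubgraph : (G : Graph) → Subset (E G) → Graph
spanningSubgraph G F = record
  { V        = V G
  ; E        = ∃[ e ] e ∈ F
  ; V-finite = V-finite G
  ; E-finite = Σ-finite (E-finite G) (T-finite ∘ F)
  ; endpoint = λ { (e , _) → endpoint G e }
  }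

IsMinimalDPDP : Graph → Set
IsMinimalDPDP G = IsDPDP G × (∀ F → (∃[ e ] e ∉ F) → ¬ IsDPDP (spanningSubgraph G F))

infix 4 _≅_

record _≅_ (G H : Graph) : Set where
  field
    V-iso : V G ↔ V H
    E-iso : E G ↔ E H
    -- The ends of each edge are preserved as an unordered pair.
    preserves-ends : ∀ e →
        (∀ s → Inverse.to V-iso (endpoint G e s) ≡ endpoint H (Inverse.to E-iso e) s)
      ⊎ (∀ s → Inverse.to V-iso (endpoint G e s) ≡ endpoint H (Inverse.to E-iso e) (not s))

cycle : (n : ℕ) .{{_ : NonZero n}} → Graph
cycle n = record
  { V        = Fin n
  ; E        = Fin n
  ; V-finite = Fin-finite n
  ; E-finite = Fin-finite n
  ; endpoint = λ { i false → i ; i true → suc (toℕ i) mod n }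
  }

LeafSet : Graph → Set
LeafSet H = Σ[ v ∈ V H ] Leaf H v

module 2-Subdivision (H : Graph) (α : LeafSet H → ℕ) where

  data OldVertex : Set where
    inner : (v : V H) → NonLeaf H v → OldVertex
    copy  : (l : LeafSet H) → Fin (α l) → OldVertex

  -- The new vertex v_e is  new e s  where s is the side of e at which v
  -- lies; for a loop e the vertices v_e^1, v_e^2 are the two sides.
  data Vertex : Set where
    old : OldVertex → Vertex
    new : E H → Bool → Vertex

  -- toInner e s  joins  new e s  to the vertex at side s of e when it is not a
  -- leaf;  toCopy e s  joins  new e s  to each of its copies when it is one.
  data Edge : Set where
    middle  : E H → Edge
    toInner : (e : E H) (s : Bool) → NonLeaf H (endpoint H e s) → Edge
    toCopy  : (e : E H) (s : Bool) (l : Leaf H (endpoint H e s)) →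
              Fin (α (endpoint H e s , l)) → Edge

  ends : Edge → Bool → Vertex
  ends (middle e)         s     = new e s
  ends (toInner e s _)    false = new e s
  ends (toInner e s n)    true  = old (inner (endpoint H e s) n)
  ends (toCopy e s _ _)   false = new e s
  ends (toCopy e s l i)   true  = old (copy (endpoint H e s , l) i)

  OldVertex-finite : Finite OldVertex
  OldVertex-finite = transport-finite
    (mk↔ₛ′ (λ { (inner v n) → inj₁ (v , n) ; (copy l i) → inj₂ (l , i) })
           (λ { (inj₁ (v , n)) → inner v n ; (inj₂ (l , i)) → copy l i })
           (λ { (inj₁ _) → refl ; (inj₂ _) → refl })
           (λ { (inner _ _) → refl ; (copy _ _) → refl }))
    (⊎-finite (Σ-finite (V-finite H) (λ _ → T-finite _))
              (Σ-finite (Σ-finite (V-finite H) (λ _ → T-finite _)) (λ l → Fin-finite (α l))))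

  Vertex-finite : Finite Vertex
  Vertex-finite = transport-finite
    (mk↔ₛ′ (λ { (old o) → inj₁ o ; (new e s) → inj₂ (e , s) })
           (λ { (inj₁ o) → old o ; (inj₂ (e , s)) → new e s })
           (λ { (inj₁ _) → refl ; (inj₂ _) → refl })
           (λ { (old _) → refl ; (new _ _) → refl }))
    (⊎-finite OldVertex-finite (Σ-finite (E-finite H) (λ _ → Bool-finite)))

  Edge-finite : Finite Edge
  Edge-finite = transport-finite
    (mk↔ₛ′ (λ { (middle e) → inj₁ e
              ; (toInner e s n) → inj₂ (inj₁ (e , s , n))
              ; (toCopy e s l i) → inj₂ (inj₂ (e , s , l , i)) })
           (λ { (inj₁ e) → middle e
              ; (inj₂ (inj₁ (e , s , n))) → toInner e s n
              ; (inj₂ (inj₂ (e , s , l , i))) → toCopy e s l i })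
           (λ { (inj₁ _) → refl ; (inj₂ (inj₁ _)) → refl ; (inj₂ (inj₂ _)) → refl })
           (λ { (middle _) → refl ; (toInner _ _ _) → refl ; (toCopy _ _ _ _) → refl }))
    (⊎-finite (E-finite H)
      (⊎-finite
        (Σ-finite (E-finite H) (λ _ → Σ-finite Bool-finite (λ _ → T-finite _)))
        (Σ-finite (E-finite H) (λ _ → Σ-finite Bool-finite (λ _ →
          Σ-finite (T-finite _) (λ _ → Fin-finite _))))))

  graph : Graph
  graph = record
    { V        = Vertex
    ; E        = Edge
    ; V-finite = Vertex-finite
    ; E-finite = Edge-finite
    ; endpoint = ends
    }

  oldVertices newVertices : Subset Vertex
  oldVertices (old _)   = true
  oldVertices (new _ _) = false
  newVertices (old _)   = false
  newVertices (new _ _) = true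

S₂ : (H : Graph) → (LeafSet H → ℕ) → Graph
S₂ = 2-Subdivision.graph

Vᵒ Vⁿ : (H : Graph) (α : LeafSet H → ℕ) → Subset (V (S₂ H α))
Vᵒ = 2-Subdivision.oldVertices
Vⁿ = 2-Subdivision.newVertices

{-# OPTIONS --safe #-}
module Submission where

-- Write a DP-pair (D , P) with matching M as a 2-colouring of the vertices.  In a minimal
-- DPDP-graph every edge outside M joins D to P and is the only such edge at one of its ends,
-- so these edges form stars; contracting the stars gives a graph H with edge set M and
-- G = S₂(H), the stars centred in P becoming the leaves of H.  If two DP-pairs differ at
-- some vertex, then that vertex and its neighbours have degree two, and this spreads over
-- the connected graph with the colours repeating along a closed walk D PP D PP ... .  Four
-- consecutive blocks D PP can be recoloured D PP DD PP DD PP D, and the resulting edge inside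
-- D is superfluous, so there are at most three blocks.  Conversely, a DP-pair of a spanning
-- subgraph is one of the whole graph, and each edge of S₂(H) is indispensable for the
-- canonical pair; the cycles are settled by a search over all colourings.

open import Axiom.UniquenessOfIdentityProofs.WithK using (uip)
open import Defs
open import Data.Bool using (Bool; true; false; not; T; _∧_; _∨_)
open import Data.Bool.Properties as Bool using (T-irrelevant; not-involutive; T?)
open import Data.Empty using (⊥; ⊥-elim)
open import Data.Fin using (Fin; zero; suc; toℕ; fromℕ<; remQuot; combine)
open import Data.Fin.Patterns using (0F; 1F; 2F; 3F; 4F; 5F; 6F; 7F; 8F)
import Data.Fin.Properties as Fin
open import Data.List using (List; []; _∷_; filter; length; cartesianProduct)
open import Data.List.Membership.Propositional using () renaming (_∈_ to _∈ˡ_)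
import Data.List.Membership.Propositional.Properties as ∈ˡ
open import Data.List.Relation.Unary.All using ([]; _∷_)
open import Data.List.Relation.Unary.AllPairs using ([]; _∷_)
open import Data.List.Relation.Unary.Any using (here; there)
open import Data.List.Relation.Unary.Unique.Propositional using (Unique)
import Data.List.Relation.Unary.Unique.Propositional.Properties as Unique
open import Data.Nat using (ℕ; zero; suc; pred; _+_; _*_; _∸_; _≤_; _<_; _<?_; z≤n; s≤s; NonZero) renaming (_≟_ to _≟ℕ_)
open import Data.Nat.DivMod using (_mod_)
import Data.Nat.Properties as ℕ
open import Data.Product using (Σ; Σ-syntax; ∃; ∃-syntax; _×_; _,_; proj₁; proj₂; uncurry)
open import Data.Sum using (_⊎_; inj₁; inj₂; [_,_]′)
open import Data.Unit using (⊤; tt)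
open import Data.Vec as Vec using (Vec; []; _∷_; tabulate)
import Data.Vec.Properties as Vec
open import Function using (_∘_; id; const)
open import Function.Bundles using (_⇔_; mk⇔; _↔_; Inverse; mk↔ₛ′; Equivalence)
open import Function.Properties.Inverse using (↔-sym)
open import Relation.Binary.Construct.Closure.ReflexiveTransitive using (Star; ε; _◅_; _◅◅_)
open import Relation.Binary.Definitions using (tri<; tri≈; tri>)
open import Relation.Binary.PropositionalEquality
open import Relation.Nullary using (¬_; Dec; yes; no; contradiction)
open import Relation.Nullary.Decidable using (True; toWitness; fromWitness; toWitnessFalse; fromWitnessFalse; map′; ¬?; _×-dec_; _⊎-dec_; _→-dec_; ⌊_⌋; decidable-stable; from-yes)
open import Relation.Unary using (Decidable)
open Graph

-- The lengths 3, 6 and 9 come from counting. In a cycle or a path a vertex of P has exactly one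
-- neighbour in P and one in D, so P falls into runs of two and D into runs of one or two. Deleting
-- an edge of a cycle leaves a path, whose end runs must be single vertices of D, so with `k` runs
-- of P it has between `3k + 1` and `4k` vertices: 4, then 7 to 8, then everything from 10 on.
-- Closed walks of `k` blocks D PP have `3k` vertices; the multiples of three that no such path
-- reaches are 3, 6 and 9, while 12 is reached, hence the role of the fourth block. The obstacle in
-- comparing two pairs is that a difference does not pass along every edge: a neighbour of a vertex
-- where they differ may lie in P for both. The invariant therefore also admits vertices of degree
-- two where only the neighbours are known to differ.

T⇒true : ∀ {b} → T b → b ≡ true
T⇒true {true} _ = refl

true⇒T : ∀ {b} → b ≡ true → T b
true⇒T refl = tt

false⇒¬T : ∀ {b} → b ≡ false → ¬ T b
false⇒¬T refl ()

¬T⇒false : ∀ {b} → ¬ T b → b ≡ false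
¬T⇒false {false} _ = refl
¬T⇒false {true}  h = contradiction tt h

true≢false : {b : Bool} → b ≡ true → b ≡ false → ⊥
true≢false refl ()

≡-or-≡not : (s t : Bool) → t ≡ s ⊎ t ≡ not s
≡-or-≡not false false = inj₁ refl
≡-or-≡not false true  = inj₂ refl
≡-or-≡not true  false = inj₂ refl
≡-or-≡not true  true  = inj₁ refl

≡not⇒≢ : (b : Bool) → b ≢ not b
≡not⇒≢ false ()
≡not⇒≢ true ()

-- Search and counting in finite types

module _ {A : Set} (A-fin : Finite A) where
  open Finite A-fin

  opaque
    any? : {Q : A → Set} → Decidable Q → Dec (∃ Q)
    any? {Q} Q? = map′
      (λ { (i , q) → Inverse.from enum i , q })
      (λ { (a , q) → Inverse.to enum a , subst Q (sym (Inverse.strictlyInverseʳ enum a)) q })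
      (Fin.any? (λ i → Q? (Inverse.from enum i)))

    all? : {Q : A → Set} → Decidable Q → Dec (∀ a → Q a)
    all? {Q} Q? = map′
      (λ h a → subst Q (Inverse.strictlyInverseʳ enum a) (h (Inverse.to enum a)))
      (λ h i → h (Inverse.from enum i))
      (Fin.all? (λ i → Q? (Inverse.from enum i)))

  inhabited⇒card : A → 1 ≤ card
  inhabited⇒card a with card | Inverse.to enum a
  ... | suc n | _ = s≤s z≤n

  card⇒inhabited : 1 ≤ card → A
  card⇒inhabited h with card | Inverse.from enum
  card⇒inhabited (s≤s _) | suc n | g = g zero

  ∈-elements : ∀ a → a ∈ˡ elements
  ∈-elements a = subst (_∈ˡ elements) (Inverse.strictlyInverseʳ enum a)
    (∈ˡ.∈-map⁺ (Inverse.from enum) (∈ˡ.∈-allFin (Inverse.to enum a)))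

  elements-unique : Unique elements
  elements-unique = Unique.map⁺
    (λ {x} {y} eq → trans (sym (Inverse.strictlyInverseˡ enum x))
                      (trans (cong (Inverse.to enum) eq) (Inverse.strictlyInverseˡ enum y)))
    (Unique.allFin⁺ card)

bijective⇒↔ : {A B : Set} (f : A → B) → (∀ {x y} → f x ≡ f y → x ≡ y) → (∀ b → ∃[ a ] f a ≡ b) → A ↔ B
bijective⇒↔ f inj surj = mk↔ₛ′ f (proj₁ ∘ surj) (proj₂ ∘ surj) (λ a → inj (proj₂ (surj (f a))))

module _ {A : Set} {Q : A → Set} (Q? : Decidable Q) {xs : List A} (xs! : Unique xs) (all∈ : ∀ a → a ∈ˡ xs) where

  length-filter≡1-intro : ∀ a → Q a → (∀ b → Q b → b ≡ a) → length (filter Q? xs) ≡ 1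
  length-filter≡1-intro a qa only
    with filter Q? xs | ∈ˡ.∈-filter⁺ Q? (all∈ a) qa | Unique.filter⁺ Q? xs! | (λ {b} → ∈ˡ.∈-filter⁻ Q? {b} {xs})
  ... | x ∷ []     | _ | _                 | _  = refl
  ... | x ∷ y ∷ zs | _ | (x≢y ∷ _) ∷ _ | mem =
    contradiction (trans (only x (proj₂ (mem (here refl)))) (sym (only y (proj₂ (mem (there (here refl))))))) x≢y

  length-filter≡1-elim : length (filter Q? xs) ≡ 1 → ∀ {a b} → Q a → Q b → a ≡ b
  length-filter≡1-elim len {a} {b} qa qb
    with filter Q? xs | ∈ˡ.∈-filter⁺ Q? (all∈ a) qa | ∈ˡ.∈-filter⁺ Q? (all∈ b) qb
  ... | x ∷ [] | here p | here q = trans p (sym q)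

  length-filter-pos : ∀ a → Q a → 1 ≤ length (filter Q? xs)
  length-filter-pos a qa with filter Q? xs | ∈ˡ.∈-filter⁺ Q? (all∈ a) qa
  ... | x ∷ _ | _ = s≤s z≤n

  length-filter-pos-elim : 1 ≤ length (filter Q? xs) → ∃ Q
  length-filter-pos-elim len with filter Q? xs | (λ {b} → ∈ˡ.∈-filter⁻ Q? {b} {xs})
  length-filter-pos-elim (s≤s _) | x ∷ _ | mem = x , proj₂ (mem (here refl))

-- Degrees by counting half-edges

module _ (G : Graph) where

  private
    sides : List Bool
    sides = false ∷ true ∷ []

    ∈-sides : ∀ s → s ∈ˡ sides
    ∈-sides false = here refl
    ∈-sides true  = there (here refl)

    halfEdges : List (E G × Bool)
    halfEdges = cartesianProduct (Finite.elements (E-finite G)) sides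

    halfEdges-unique : Unique halfEdges
    halfEdges-unique = Unique.cartesianProduct⁺ (elements-unique (E-finite G)) (((λ ()) ∷ []) ∷ ([] ∷ []))

    ∈-halfEdges : ∀ h → h ∈ˡ halfEdges
    ∈-halfEdges (e , s) = ∈ˡ.∈-cartesianProduct⁺ (∈-elements (E-finite G) e) (∈-sides s)

  degree≡1-intro : ∀ {v} e s → endpoint G e s ≡ v →
    (∀ e′ s′ → endpoint G e′ s′ ≡ v → (e′ , s′) ≡ (e , s)) → degree G v ≡ 1
  degree≡1-intro e s eq only = length-filter≡1-intro _ halfEdges-unique ∈-halfEdges (e , s) eq (λ { (e′ , s′) → only e′ s′ })

  degree≡1-elim : ∀ {v e s e′ s′} → degree G v ≡ 1 → endpoint G e s ≡ v → endpoint G e′ s′ ≡ v →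
    (e , s) ≡ (e′ , s′)
  degree≡1-elim len p q = length-filter≡1-elim _ halfEdges-unique ∈-halfEdges len p q

  degree-pos : ∀ {v} e s → endpoint G e s ≡ v → 1 ≤ degree G v
  degree-pos e s eq = length-filter-pos _ halfEdges-unique ∈-halfEdges (e , s) eq

  degree-pos-elim : ∀ {v} → 1 ≤ degree G v → ∃[ e ] ∃[ s ] endpoint G e s ≡ v
  degree-pos-elim len with length-filter-pos-elim _ halfEdges-unique ∈-halfEdges len
  ... | (e , s) , eq = e , s , eq

-- Isomorphisms, and DP-pairs as 2-colourings

≅-sym : ∀ {G H} → G ≅ H → H ≅ G
≅-sym {G} {H} i = record
  { V-iso = ↔-sym V-iso
  ; E-iso = ↔-sym E-iso
  ; preserves-ends = λ e → [ (λ h → inj₁ (λ s → ends e s s (h s)))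
                           , (λ h → inj₂ (λ s → trans
                               (cong (λ t → Inverse.from V-iso (endpoint H e t)) (sym (not-involutive s)))
                               (ends e (not (not s)) (not s) (h (not s))))) ]′
                           (preserves-ends (Inverse.from E-iso e))
  }
  where
  open _≅_ i
  ends : ∀ e s t → Inverse.to V-iso (endpoint G (Inverse.from E-iso e) t)
                     ≡ endpoint H (Inverse.to E-iso (Inverse.from E-iso e)) s →
         Inverse.from V-iso (endpoint H e s) ≡ endpoint G (Inverse.from E-iso e) t
  ends e s t eq = trans
    (cong (Inverse.from V-iso)
      (trans (cong (λ x → endpoint H x s) (sym (Inverse.strictlyInverseˡ E-iso e))) (sym eq)))
    (Inverse.strictlyInverseʳ V-iso _)

-- A DP-pair (D , P) with a perfect matching M of P, all using only edges that
-- satisfy F; colour v is true exactly when v is in P.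
record Pair (G : Graph) (F : E G → Set) : Set where
  field
    colour      : V G → Bool
    M           : E G → Bool
    dominated   : ∀ v → ∃[ e ] ∃[ s ] (F e × endpoint G e s ≡ v × colour (endpoint G e (not s)) ≡ not (colour v))
    M⊆F         : ∀ {e} → M e ≡ true → F e
    M-ends      : ∀ {e} s → M e ≡ true → colour (endpoint G e s) ≡ true
    M-loopless  : ∀ {e} → M e ≡ true → ¬ Loop G e
    mate        : ∀ v → colour v ≡ true → ∃[ e ] ∃[ s ] (M e ≡ true × endpoint G e s ≡ v)
    mate-unique : ∀ {e s e′ s′} → M e ≡ true → M e′ ≡ true → endpoint G e s ≡ endpoint G e′ s′ → e ≡ e′

open Pair

Any : {A : Set} → A → Set
Any _ = ⊤

-- Restricting a pair by a predicate on edges keeps pairs of subgraphs on `G` itself, so that no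
-- edge changes its type. Single edges suffice, because a pair of a spanning subgraph is also one of
-- every larger spanning subgraph.
Critical : Graph → Set
Critical G = ∀ e → ¬ Pair G (_≢ e)

weaken : ∀ {G F F′} → (∀ {e} → F e → F′ e) → Pair G F → Pair G F′
weaken F⊆F′ π = record
  { colour = colour π ; M = M π
  ; dominated = λ v → let (e , s , f , eqs) = dominated π v in e , s , F⊆F′ f , eqs
  ; M⊆F = λ m → F⊆F′ (M⊆F π m)
  ; M-ends = M-ends π ; M-loopless = M-loopless π ; mate = mate π ; mate-unique = mate-unique π }

transport-Pair : ∀ {G H F F′} (i : G ≅ H) →
  (∀ {e} → F e → F′ (Inverse.to (_≅_.E-iso i) e)) → Pair G F → Pair H F′
transport-Pair {G} {H} {F} {F′} i F⊆F′ π = record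
  { colour = c
  ; M = M π ∘ g⁻
  ; dominated = dom
  ; M⊆F = λ {e} m → subst F′ (Inverse.strictlyInverseˡ E-iso e) (F⊆F′ (M⊆F π m))
  ; M-ends = λ {e} s m → let (t , eq , _) = side e s in trans (cong (colour π) eq) (M-ends π t m)
  ; M-loopless = λ {e} m lp → M-loopless π m (loop (g⁻ e)
      (trans (cong (λ x → endpoint H x false) (Inverse.strictlyInverseˡ E-iso e))
        (trans lp (cong (λ x → endpoint H x true) (sym (Inverse.strictlyInverseˡ E-iso e))))))
  ; mate = λ v cv → let (e , s , m , eq) = mate π (f⁻ v) cv
                        (t , eq′) = side′ e s
                    in g e , t , trans (cong (M π) (Inverse.strictlyInverseʳ E-iso e)) m
                       , trans (sym eq′) (trans (cong f eq) (Inverse.strictlyInverseˡ V-iso v))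
  ; mate-unique = λ {e} {s} {e′} {s′} m m′ eq →
      let (t , p , _) = side e s ; (t′ , p′ , _) = side e′ s′ in
      g⁻-inj (mate-unique π m m′ (trans (sym p) (trans (cong f⁻ eq) p′)))
  }
  where
  open _≅_ i
  f = Inverse.to V-iso
  f⁻ = Inverse.from V-iso
  g = Inverse.to E-iso
  g⁻ = Inverse.from E-iso
  c = colour π ∘ f⁻
  g⁻-inj : ∀ {x y} → g⁻ x ≡ g⁻ y → x ≡ y
  g⁻-inj {x} {y} eq = trans (sym (Inverse.strictlyInverseˡ E-iso x)) (trans (cong g eq) (Inverse.strictlyInverseˡ E-iso y))
  f-inj : ∀ {x y} → f x ≡ f y → x ≡ y
  f-inj {x} {y} eq = trans (sym (Inverse.strictlyInverseʳ V-iso x)) (trans (cong f⁻ eq) (Inverse.strictlyInverseʳ V-iso y))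
  side : ∀ e s → ∃[ t ] (f⁻ (endpoint H e s) ≡ endpoint G (g⁻ e) t
                       × f⁻ (endpoint H e (not s)) ≡ endpoint G (g⁻ e) (not t))
  side e s with _≅_.preserves-ends (≅-sym i) e
  ... | inj₁ h = s , h s , h (not s)
  ... | inj₂ h = not s , h s , h (not s)
  side′ : ∀ e s → ∃[ t ] (f (endpoint G e s) ≡ endpoint H (g e) t)
  side′ e s with preserves-ends e
  ... | inj₁ h = s , h s
  ... | inj₂ h = not s , h s
  loop : ∀ e → Loop H (g e) → Loop G e
  loop e lp with preserves-ends e
  ... | inj₁ h = f-inj (trans (h false) (trans lp (sym (h true))))
  ... | inj₂ h = f-inj (trans (h false) (trans (sym lp) (sym (h true))))
  dom : ∀ v → ∃[ e ] ∃[ s ] (F′ e × endpoint H e s ≡ v × c (endpoint H e (not s)) ≡ not (c v))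
  dom v with dominated π (f⁻ v)
  ... | e , s , fe , eq , col with preserves-ends e
  ... | inj₁ h = g e , s , F⊆F′ fe
      , trans (sym (h s)) (trans (cong f eq) (Inverse.strictlyInverseˡ V-iso v))
      , trans (cong (colour π) (trans (cong f⁻ (sym (h (not s)))) (Inverse.strictlyInverseʳ V-iso _))) col
  ... | inj₂ h = g e , not s , F⊆F′ fe
      , trans (sym (h s)) (trans (cong f eq) (Inverse.strictlyInverseˡ V-iso v))
      , trans (cong (colour π) (trans (cong f⁻ (sym (h (not s)))) (Inverse.strictlyInverseʳ V-iso _))) col

transport-Critical : ∀ {G H} → G ≅ H → Critical G → Critical H
transport-Critical {G} {H} i crit e π = crit (Inverse.from E-iso e)
  (transport-Pair (≅-sym i) (λ ne eq → ne (trans (sym (Inverse.strictlyInverseˡ E-iso _))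
     (trans (cong (Inverse.to E-iso) eq) (Inverse.strictlyInverseˡ E-iso e)))) π)
  where open _≅_ i

transport-Connected : ∀ {G H} → G ≅ H → Connected G → Connected H
transport-Connected {G} {H} i (pos , conn) =
    inhabited⇒card (V-finite H) (f (card⇒inhabited (V-finite G) pos))
  , λ u v → subst₂ (Star (Adjacent H)) (Inverse.strictlyInverseˡ V-iso u) (Inverse.strictlyInverseˡ V-iso v)
      (walk (conn (Inverse.from V-iso u) (Inverse.from V-iso v)))
  where
  open _≅_ i
  f = Inverse.to V-iso
  adj : ∀ {u v} → Adjacent G u v → Adjacent H (f u) (f v)
  adj (e , s , refl , refl) with preserves-ends e
  ... | inj₁ h = Inverse.to E-iso e , s , sym (h s) , sym (h (not s))
  ... | inj₂ h = Inverse.to E-iso e , not s , sym (h s) , sym (h (not s))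
  walk : ∀ {u v} → Star (Adjacent G) u v → Star (Adjacent H) (f u) (f v)
  walk ε = ε
  walk (a ◅ as) = adj a ◅ walk as

module _ {G : Graph} where

  Pair⇒DPPair : (π : Pair G Any) {D P : Subset (V G)} → D ≗ not ∘ colour π → P ≗ colour π → IsDPPair G D P
  Pair⇒DPPair π {D} {P} D≗ P≗ = record
    { disjoint = λ v (d , p) → ≡not⇒≢ (colour π v) (trans (trans (sym (P≗ v)) (T⇒true p)) (trans (sym (T⇒true d)) (D≗ v)))
    ; covers = covers′
    ; dominating = nbr not (λ { true _ → refl }) D≗
    ; pairedDominating = nbr id (λ { false _ → refl }) P≗ , M π
        , (λ e m → (λ s → true⇒T (trans (P≗ _) (M-ends π s (T⇒true m)))) , M-loopless π (T⇒true m))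
        , λ v p → let (e , s , m , eq) = mate π v (trans (sym (P≗ v)) (T⇒true p)) in
            e , (true⇒T m , s , eq) , λ { (m′ , s′ , eq′) → mate-unique π m (T⇒true m′) (trans eq (sym eq′)) }
    }
    where
    covers′ : ∀ v → v ∈ D ⊎ v ∈ P
    covers′ v rewrite D≗ v | P≗ v with colour π v
    ... | true = inj₂ tt
    ... | false = inj₁ tt
    nbr : (f : Bool → Bool) → (∀ b → f b ≡ false → f (not b) ≡ true) →
          {X : Subset (V G)} → X ≗ f ∘ colour π → Dominating G X
    nbr f flip {X} X≗ v v∉X with dominated π v
    ... | e , s , _ , eq , col = endpoint G e (not s)
        , true⇒T (trans (X≗ _) (trans (cong f col) (flip _ (trans (sym (X≗ v)) (¬T⇒false v∉X)))))
        , e , s , eq , refl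

  module _ {D P : Subset (V G)} (dp : IsDPPair G D P) where
    open IsDPPair dp

    D≗not-P : D ≗ not ∘ P
    D≗not-P v with D v in d | P v in p | covers v
    ... | true  | true  | _ = contradiction (true⇒T d , true⇒T p) (disjoint v)
    ... | true  | false | _ = refl
    ... | false | true  | _ = refl
    ... | false | false | inj₁ ()
    ... | false | false | inj₂ ()

    -- The equation is returned so that matching on `refl` identifies an arbitrary `P` with a
    -- colouring.
    DPPair⇒Pair : Σ[ π ∈ Pair G Any ] colour π ≡ P
    DPPair⇒Pair = record
      { colour = P
      ; M = proj₁ matching
      ; dominated = dom
      ; M⊆F = λ _ → tt
      ; M-ends = λ {e} s m → T⇒true (proj₁ (proj₁ (proj₂ matching) e (true⇒T m)) s)
      ; M-loopless = λ {e} m → proj₂ (proj₁ (proj₂ matching) e (true⇒T m))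
      ; mate = λ v cv → let (e , (m , s , eq) , _) = proj₂ (proj₂ matching) v (true⇒T cv) in e , s , T⇒true m , eq
      ; mate-unique = λ {e} {s} {e′} {s′} m m′ eq →
          let (_ , _ , only) = proj₂ (proj₂ matching) (endpoint G e s) (proj₁ (proj₁ (proj₂ matching) e (true⇒T m)) s)
          in trans (sym (only (true⇒T m , s , refl))) (only (true⇒T m′ , s′ , sym eq))
      } , refl
      where
      matching = proj₂ pairedDominating
      dom : ∀ v → ∃[ e ] ∃[ s ] (Any e × endpoint G e s ≡ v × P (endpoint G e (not s)) ≡ not (P v))
      dom v with P v in p
      ... | true with dominating v (λ d → disjoint v (d , true⇒T p))
      ...   | u , d , e , s , eq , eq′ = e , s , tt , eq , ¬T⇒false (λ p′ → disjoint u (d , subst (T ∘ P) eq′ p′))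
      dom v | false with proj₁ pairedDominating v (false⇒¬T p)
      ...   | u , p′ , e , s , eq , eq′ = e , s , tt , eq , trans (cong P eq′) (T⇒true p′)

  IsDPDP⇒Pair : IsDPDP G → Pair G Any
  IsDPDP⇒Pair (_ , _ , dp) = proj₁ (DPPair⇒Pair dp)

  Pair⇒IsDPDP : Pair G Any → IsDPDP G
  Pair⇒IsDPDP π = _ , _ , Pair⇒DPPair π (λ _ → refl) (λ _ → refl)

module _ {G : Graph} where

  restrict-Pair : ∀ {F : Subset (E G)} → Pair G (_∈ F) → Pair (spanningSubgraph G F) Any
  restrict-Pair π = record
    { colour = colour π
    ; M = M π ∘ proj₁
    ; dominated = λ v → let (e , s , f , eqs) = dominated π v in (e , f) , s , tt , eqs
    ; M⊆F = λ _ → tt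
    ; M-ends = M-ends π
    ; M-loopless = M-loopless π
    ; mate = λ v cv → let (e , s , m , eq) = mate π v cv in (e , M⊆F π m) , s , m , eq
    ; mate-unique = λ {e} {s} {e′} {s′} m m′ eq → Σ-T-≡ (mate-unique π {s = s} {s′ = s′} m m′ eq)
    }
    where
    Σ-T-≡ : ∀ {A : Set} {F : Subset A} {x y : Σ A (_∈ F)} → proj₁ x ≡ proj₁ y → x ≡ y
    Σ-T-≡ {x = _ , p} {_ , q} refl = cong (_ ,_) (T-irrelevant p q)

  extend-Pair : ∀ {F : Subset (E G)} → Pair (spanningSubgraph G F) Any → Pair G (_∈ F)
  extend-Pair {F} π = record
    { colour = colour π
    ; M = M′
    ; dominated = λ v → let ((e , f) , s , _ , eqs) = dominated π v in e , s , f , eqs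
    ; M⊆F = λ {e} m → proj₁ (inM e m)
    ; M-ends = λ {e} s m → M-ends π s (proj₂ (inM e m))
    ; M-loopless = λ {e} m → M-loopless π (proj₂ (inM e m))
    ; mate = λ v cv → let ((e , f) , s , m , eq) = mate π v cv in e , s , M-in e f m , eq
    ; mate-unique = λ {e} {s} {e′} {s′} m m′ eq → cong proj₁ (mate-unique π {s = s} {s′ = s′} (proj₂ (inM e m)) (proj₂ (inM e′ m′)) eq)
    }
    where
    M′ : E G → Bool
    M′ e with T? (F e)
    ... | yes f = M π (e , f)
    ... | no _  = false
    inM : ∀ e → M′ e ≡ true → Σ[ f ∈ e ∈ F ] M π (e , f) ≡ true
    inM e m with T? (F e)
    ... | yes f = f , m
    M-in : ∀ e (f : e ∈ F) → M π (e , f) ≡ true → M′ e ≡ true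
    M-in e f m with T? (F e)
    ... | yes f′ = trans (cong (λ t → M π (e , t)) (T-irrelevant f′ f)) m
    ... | no ¬f  = contradiction f ¬f

  -- One way, the subgraph is taken to consist of all edges but `e`; the other way, any edge outside
  -- `F` serves as `e`.
  IsMinimalDPDP⇔Critical : IsMinimalDPDP G ⇔ (IsDPDP G × Critical G)
  IsMinimalDPDP⇔Critical = mk⇔
    (λ (dpdp , min) → dpdp , λ e π →
      let ne = λ x → ⌊ ¬? (Finite._≟_ (E-finite G) x e) ⌋ in
      min ne (e , λ t → toWitness {a? = ¬? (Finite._≟_ (E-finite G) e e)} t refl)
        (Pair⇒IsDPDP (restrict-Pair (weaken (λ {x} → fromWitness {a? = ¬? (Finite._≟_ (E-finite G) x e)}) π))))
    (λ (dpdp , crit) → dpdp , λ F (e , e∉F) dpdp′ → crit e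
      (weaken (λ { f refl → e∉F f }) (extend-Pair {F} (IsDPDP⇒Pair dpdp′))))

-- The canonical pair of a 2-subdivision graph

module _ (H : Graph) (α : LeafSet H → ℕ) where
  open 2-Subdivision H α

  -- The middle edges are the matching. Old vertices are dominated because the vertex of `H` behind
  -- them has an edge; a new vertex at a leaf is dominated because the leaf has at least one copy.
  canonicalPair : NoIsolatedVertex H → (∀ l → 1 ≤ α l) → Pair (S₂ H α) Any
  canonicalPair noIso α≥1 = record
    { colour = Vⁿ H α
    ; M = isMiddle
    ; dominated = dom
    ; M⊆F = λ _ → tt
    ; M-ends = λ { {middle e} s _ → refl }
    ; M-loopless = λ { {middle e} _ () }
    ; mate = λ { (new e s) _ → middle e , s , refl , refl }
    ; mate-unique = λ { {middle e} {s} {middle .e} {.s} _ _ refl → refl }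
    }
    where
    isMiddle : Edge → Bool
    isMiddle (middle _) = true
    isMiddle (toInner _ _ _) = false
    isMiddle (toCopy _ _ _ _) = false
    dom : ∀ v → ∃[ e ] ∃[ s ] (Any e × ends e s ≡ v × Vⁿ H α (ends e (not s)) ≡ not (Vⁿ H α v))
    dom (new e s) with degree H (endpoint H e s) ≟ℕ 1
    ... | yes d = let l = fromWitness d in
                  toCopy e s l (card⇒inhabited (Fin-finite _) (α≥1 (endpoint H e s , l))) , false , tt , refl , refl
    ... | no  d = toInner e s (fromWitnessFalse d) , false , tt , refl , refl
    dom (old (inner v n)) with degree-pos-elim H (noIso v)
    ... | e , s , refl = toInner e s n , true , tt , refl , refl
    dom (old (copy (v , l) i)) with degree-pos-elim H (noIso v)
    ... | e , s , refl = toCopy e s l i , true , tt , refl , refl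

  private
    copy-injective : ∀ {l l′ i i′} → Vertex.old (copy l i) ≡ old (copy l′ i′) →
      _≡_ {A = Σ (LeafSet H) (Fin ∘ α)} (l , i) (l′ , i′)
    copy-injective refl = refl

    -- A leaf of `H` has a single half-edge, so each of its copies has degree one.
    toCopy-unique : ∀ {e s l i e′ s′ l′ i′} → ends (toCopy e s l i) true ≡ ends (toCopy e′ s′ l′ i′) true →
      toCopy e s l i ≡ toCopy e′ s′ l′ i′
    toCopy-unique {e} {s} {l} {i} {e′} {s′} {l′} {i′} eq
      with degree≡1-elim H {e = e} {s} {e′} {s′} (toWitness l) refl (sym (cong (proj₁ ∘ proj₁) (copy-injective eq)))
    ... | refl with T-irrelevant l l′
    ... | refl with copy-injective eq
    ... | refl = refl

  -- A pair avoiding `e₀` is a pair of the whole graph, hence canonical, and every edge is vital to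
  -- some vertex: a new vertex can have its mate only across the middle edge, at a non-leaf it meets
  -- D only across its `toInner` edge, and a copy has no edge but its own.
  only-canonical⇒Critical : NoIsolatedVertex H → (∀ l → 1 ≤ α l) →
    (∀ D P → IsDPPair (S₂ H α) D P → D ≗ Vᵒ H α × P ≗ Vⁿ H α) → Critical (S₂ H α)
  only-canonical⇒Critical noIso α≥1 only e₀ π = absurd e₀ (M⊆F π) (dominated π)
    where
    colour≗ : colour π ≗ Vⁿ H α
    colour≗ = proj₂ (only _ _ (Pair⇒DPPair (weaken (const tt) π) (λ _ → refl) (λ _ → refl)))

    absurd : ∀ e₀ → (∀ {e} → M π e ≡ true → e ≢ e₀) →
      (∀ v → ∃[ e ] ∃[ s ] (e ≢ e₀ × ends e s ≡ v × colour π (ends e (not s)) ≡ not (colour π v))) → ⊥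
    absurd (middle e) avoid _ with mate π (new e false) (colour≗ _)
    ... | middle _        , _     , m , refl = avoid m refl
    ... | toInner _ _ _   , false , m , _    = true≢false (M-ends π true m) (colour≗ _)
    ... | toCopy _ _ _ _  , false , m , _    = true≢false (M-ends π true m) (colour≗ _)
    absurd (toInner e s n) _ dom with dom (new e s)
    ... | middle _        , _     , _  , refl , col = true≢false (colour≗ _) (trans col (cong not (colour≗ _)))
    ... | toInner _ _ n′  , false , ne , refl , _   = ne (cong (toInner e s) (T-irrelevant n′ n))
    ... | toCopy _ _ l _  , false , _  , refl , _   = toWitnessFalse {a? = degree H (endpoint H e s) ≟ℕ 1} n (toWitness l)
    absurd (toCopy e s l i) _ dom with dom (old (copy (endpoint H e s , l) i))
    ... | middle _        , _     , _  , ()   , _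
    ... | toInner _ _ _   , false , _  , ()   , _
    ... | toInner _ _ _   , true  , _  , ()   , _
    ... | toCopy _ _ _ _  , false , _  , ()   , _
    ... | toCopy _ _ _ _  , true  , ne , eq   , _   = ne (toCopy-unique eq)

-- The cycles of length 3, 6 and 9

forallVec : (n : ℕ) → (Vec Bool n → Bool) → Bool
forallVec zero  f = f []
forallVec (suc n) f = forallVec n (f ∘ (false ∷_)) ∧ forallVec n (f ∘ (true ∷_))

∧-elim : ∀ a {b} → a ∧ b ≡ true → a ≡ true × b ≡ true
∧-elim true eq = refl , eq

forallVec-sound : ∀ n f → forallVec n f ≡ true → ∀ xs → f xs ≡ true
forallVec-sound zero  f eq [] = eq
forallVec-sound (suc n) f eq (false ∷ xs) = forallVec-sound n _ (proj₁ (∧-elim (forallVec n (f ∘ (false ∷_))) eq)) xs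
forallVec-sound (suc n) f eq (true ∷ xs)  = forallVec-sound n _ (proj₂ (∧-elim (forallVec n (f ∘ (false ∷_))) eq)) xs

module CycleSearch (n : ℕ) .{{_ : NonZero n}} where

  next prev : Fin n → Fin n
  next i = suc (toℕ i) mod n
  prev i = (toℕ i + pred n) mod n

  private
    _==_ : Bool → Bool → Bool
    true  == b = b
    false == b = not b

    _≠_ : Fin n → Fin n → Bool
    i ≠ j = not ⌊ i Fin.≟ j ⌋

  -- e is the deleted edge.
  hasNeighbour : Fin n → (Fin n → Bool) → Fin n → Bool → Bool
  hasNeighbour e c i b = ((i ≠ e) ∧ (c (next i) == b)) ∨ ((prev i ≠ e) ∧ (c (prev i) == b))

  -- A relaxation: a vertex of P is only required to have some neighbour in P, not a mate in a
  -- perfect matching. For the lengths in question this already excludes every colouring.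
  locallyOK : Fin n → (Fin n → Bool) → Fin n → Bool
  locallyOK e c i = hasNeighbour e c i (not (c i)) ∧ (not (c i) ∨ hasNeighbour e c i true)

  refuted : Fin n → Vec Bool n → Bool
  refuted e xs = not ⌊ Fin.all? (λ i → T? (locallyOK e (Vec.lookup xs) i)) ⌋

  cycle-Critical : (∀ i → prev (next i) ≡ i) → (∀ e → forallVec n (refuted e) ≡ true) → Critical (cycle n)
  cycle-Critical prev-next check e π =
    not-⌊⌋ (Fin.all? (λ i → T? (locallyOK e c i))) (forallVec-sound n (refuted e) (check e) xs) ok
    where
    xs : Vec Bool n
    xs = tabulate (colour π)

    c : Fin n → Bool
    c = Vec.lookup xs

    c≗ : c ≗ colour π
    c≗ = Vec.lookup∘tabulate (colour π)

    not-⌊⌋ : ∀ {A : Set} (a? : Dec A) → not ⌊ a? ⌋ ≡ true → ¬ A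
    not-⌊⌋ (no ¬a) _ = ¬a

    ==-refl : ∀ b → T (b == b)
    ==-refl false = tt
    ==-refl true  = tt

    ≠-intro : ∀ {i} → i ≢ e → (i ≠ e) ≡ true
    ≠-intro {i} ne with i Fin.≟ e
    ... | yes eq = contradiction eq ne
    ... | no _   = refl

    ∧-intro : ∀ {a b} → T a → T b → T (a ∧ b)
    ∧-intro {true} _ t = t

    ∨-introˡ : ∀ {a b} → T a → T (a ∨ b)
    ∨-introˡ {true} _ = tt

    ∨-introʳ : ∀ {a b} → T b → T (a ∨ b)
    ∨-introʳ {false} t = t
    ∨-introʳ {true}  _ = tt

    hasNeighbour-intro : ∀ {i b} x s → x ≢ e → endpoint (cycle n) x s ≡ i →
      colour π (endpoint (cycle n) x (not s)) ≡ b → T (hasNeighbour e c i b)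
    hasNeighbour-intro x false ne refl refl
      rewrite ≠-intro ne | c≗ (next x) = ∨-introˡ (==-refl (colour π (next x)))
    -- Edge `x` runs from `x` to `next x`; seen from the far end it leads to `prev (next x)` and
    -- bears that number, hence the second disjunct.
    hasNeighbour-intro x true ne refl refl
      rewrite prev-next x | ≠-intro ne | c≗ x = ∨-introʳ {(next x ≠ e) ∧ (c (next (next x)) == colour π x)} (==-refl (colour π x))

    ok : ∀ i → T (locallyOK e c i)
    ok i with c i in ci | dominated π i
    ... | false | x , s , ne , eq , col = ∧-intro (hasNeighbour-intro x s ne eq (trans col (cong not (trans (sym (c≗ i)) ci)))) tt
    ... | true  | x , s , ne , eq , col with mate π i (trans (sym (c≗ i)) ci)
    ...   | y , t , m , eq′ = ∧-intro (hasNeighbour-intro x s ne eq (trans col (cong not (trans (sym (c≗ i)) ci))))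
              (hasNeighbour-intro y t (M⊆F π m) eq′ (M-ends π (not t) m))

cycle3-Critical : Critical (cycle 3)
cycle3-Critical = cycle-Critical (from-yes (Fin.all? (λ i → prev (next i) Fin.≟ i)))
  (from-yes (Fin.all? (λ e → forallVec 3 (refuted e) Bool.≟ true)))
  where open CycleSearch 3

cycle6-Critical : Critical (cycle 6)
cycle6-Critical = cycle-Critical (from-yes (Fin.all? (λ i → prev (next i) Fin.≟ i)))
  (from-yes (Fin.all? (λ e → forallVec 6 (refuted e) Bool.≟ true)))
  where open CycleSearch 6

cycle9-Critical : Critical (cycle 9)
cycle9-Critical = cycle-Critical (from-yes (Fin.all? (λ i → prev (next i) Fin.≟ i)))
  (from-yes (Fin.all? (λ e → forallVec 9 (refuted e) Bool.≟ true)))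
  where open CycleSearch 9

-- Stars formed by the edges outside the matching

module Structure (G : Graph) (crit : Critical G) (π : Pair G Any) where

  end : E G → Bool → V G
  end = endpoint G

  c : V G → Bool
  c = colour π

  opaque
    _≟ᴱ_ : (x y : E G) → Dec (x ≡ y)
    _≟ᴱ_ = Finite._≟_ (E-finite G)

    _≟ⱽ_ : (x y : V G) → Dec (x ≡ y)
    _≟ⱽ_ = Finite._≟_ (V-finite G)

  anyHalfEdge? : {Q : E G → Bool → Set} → (∀ e s → Dec (Q e s)) → Dec (∃[ e ] ∃[ s ] Q e s)
  anyHalfEdge? Q? = any? (E-finite G) (λ e → any? Bool-finite (Q? e))

  -- Losing an edge outside the matching can only spoil domination; if domination survives, the same
  -- colouring and matching form a pair avoiding that edge.
  non-redundant : ∀ e₀ → M π e₀ ≡ false →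
    ¬ (∀ v → ∃[ e ] ∃[ s ] (e ≢ e₀ × end e s ≡ v × c (end e (not s)) ≡ not (c v)))
  non-redundant e₀ m₀ dom = crit e₀ (record
    { colour = c ; M = M π ; dominated = dom ; M⊆F = λ { m refl → true≢false m m₀ }
    ; M-ends = M-ends π ; M-loopless = M-loopless π ; mate = mate π ; mate-unique = mate-unique π })

  crossing : ∀ {e} s → M π e ≡ false → c (end e (not s)) ≡ not (c (end e s))
  crossing {e} s m with c (end e (not s)) Bool.≟ not (c (end e s))
  ... | yes eq = eq
  ... | no neq = ⊥-elim (non-redundant e m dom)
    where
    mono : ∀ t → c (end e (not t)) ≢ not (c (end e t))
    mono t eq with ≡-or-≡not s t
    ... | inj₁ refl = neq eq
    ... | inj₂ refl = neq (trans (sym (not-involutive _)) (cong not (trans (sym eq) (cong (c ∘ end e) (not-involutive s)))))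
    dom : ∀ v → ∃[ x ] ∃[ t ] (x ≢ e × end x t ≡ v × c (end x (not t)) ≡ not (c v))
    dom v with dominated π v
    ... | x , t , _ , refl , col = x , t , (λ { refl → mono t col }) , refl , col

  -- By crossing, the edges outside M are the edges between D and P.
  OnlyAt : E G → Bool → Set
  OnlyAt e s = ∀ x t → M π x ≡ false → end x t ≡ end e s → x ≡ e

  private
    alternative? : ∀ e s → (∃[ x ] ∃[ t ] (M π x ≡ false × end x t ≡ end e s × x ≢ e)) ⊎ OnlyAt e s
    alternative? e s with anyHalfEdge? (λ x t → (M π x Bool.≟ false) ×-dec (end x t ≟ⱽ end e s) ×-dec ¬? (x ≟ᴱ e))
    ... | yes h = inj₁ h
    ... | no ¬h = inj₂ (λ x t m eq → decidable-stable (x ≟ᴱ e) (λ ne → ¬h (x , t , m , eq , ne)))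

  -- If each end had a further edge outside the matching, these edges would by `crossing` lead to
  -- the opposite colour and dominate both ends without `e`.
  star : ∀ {e} → M π e ≡ false → ∀ s → OnlyAt e s ⊎ OnlyAt e (not s)
  star {e} m s with alternative? e s | alternative? e (not s)
  ... | inj₂ u | _ = inj₁ u
  ... | inj₁ _ | inj₂ u = inj₂ u
  ... | inj₁ (x , t , mx , eqx , nex) | inj₁ (y , r , my , eqy , ney) = ⊥-elim (non-redundant e m dom)
    where
    dom : ∀ v → ∃[ z ] ∃[ q ] (z ≢ e × end z q ≡ v × c (end z (not q)) ≡ not (c v))
    dom v with dominated π v
    ... | z , q , _ , refl , col with z ≟ᴱ e
    ...   | no ne = z , q , ne , refl , col
    ...   | yes refl with ≡-or-≡not s q
    ...     | inj₁ refl = x , t , nex , eqx , trans (crossing t mx) (cong (not ∘ c) eqx)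
    ...     | inj₂ refl = y , r , ney , eqy , trans (crossing r my) (cong (not ∘ c) eqy)

  loopless : ∀ e → ¬ Loop G e
  loopless e lp with M π e in m
  ... | true  = M-loopless π m lp
  ... | false = ≡not⇒≢ (c (end e false)) (trans (cong c lp) (crossing false m))

  side-unique : ∀ {e s t} → end e s ≡ end e t → s ≡ t
  side-unique {s = false} {false} eq = refl
  side-unique {s = false} {true}  eq = contradiction eq (loopless _)
  side-unique {s = true}  {false} eq = contradiction (sym eq) (loopless _)
  side-unique {s = true}  {true}  eq = refl

  D-edge : ∀ {e} s → c (end e s) ≡ false → M π e ≡ false
  D-edge {e} s d with M π e in m
  ... | true  = contradiction d (true≢false (M-ends π s m))
  ... | false = refl

  P-end-unique : ∀ {e s t} → M π e ≡ false → c (end e s) ≡ true → c (end e t) ≡ true → end e s ≡ end e t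
  P-end-unique {e} {s} {t} m cs ct with ≡-or-≡not s t
  ... | inj₁ refl = refl
  ... | inj₂ refl = contradiction (trans (crossing s m) (cong not cs)) (true≢false ct)

  P-end : ∀ e → M π e ≡ false → ∃[ t ] c (end e t) ≡ true
  P-end e m with c (end e false) in cf
  ... | true  = false , cf
  ... | false = true , trans (crossing false m) (cong not cf)

  link : V G → E G
  link v = proj₁ (dominated π v)
  linkSide : V G → Bool
  linkSide v = proj₁ (proj₂ (dominated π v))
  link-end : ∀ v → end (link v) (linkSide v) ≡ v
  link-end v = proj₁ (proj₂ (proj₂ (proj₂ (dominated π v))))
  δ : V G → V G
  δ v = end (link v) (not (linkSide v))
  c-δ : ∀ v → c (δ v) ≡ not (c v)
  c-δ v = proj₂ (proj₂ (proj₂ (proj₂ (dominated π v))))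
  link∉M : ∀ v → M π (link v) ≡ false
  link∉M v with M π (link v) in m
  ... | false = refl
  ... | true  = ⊥-elim (≡not⇒≢ (c v) (trans
        (trans (sym (cong c (link-end v))) (trans (M-ends π (linkSide v) m) (sym (M-ends π (not (linkSide v)) m)))) (c-δ v)))

  mateEdge : ∀ v → c v ≡ true → E G
  mateEdge v p = proj₁ (mate π v p)
  mateSide : ∀ v → c v ≡ true → Bool
  mateSide v p = proj₁ (proj₂ (mate π v p))
  mate∈M : ∀ v p → M π (mateEdge v p) ≡ true
  mate∈M v p = proj₁ (proj₂ (proj₂ (mate π v p)))
  mate-end : ∀ v p → end (mateEdge v p) (mateSide v p) ≡ v
  mate-end v p = proj₂ (proj₂ (proj₂ (mate π v p)))

  -- As `G` has no loops, this is degree one.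
  Pendant : V G → Set
  Pendant v = ∀ e s → end e s ≡ v → e ≡ link v

  pendant? : ∀ v → Dec (Pendant v)
  pendant? v = all? (E-finite G) (λ e → all? Bool-finite (λ s → (end e s ≟ⱽ v) →-dec (e ≟ᴱ link v)))

  -- No matching edge meets D, so at a vertex of D the edges outside the matching are all the edges.
  OnlyAt-D⇒Pendant : ∀ {e s} → c (end e s) ≡ false → OnlyAt e s → Pendant (end e s)
  OnlyAt-D⇒Pendant {e} {s} d u x t eq = trans
    (u x t (D-edge t (trans (cong c eq) d)) eq)
    (sym (u (link (end e s)) (linkSide (end e s)) (link∉M _) (link-end _)))

  -- If `x` is alone at its end in D, that end is pendant. Otherwise it is alone at the common end
  -- in P, and then `e` and `x` are the same edge.
  pendant-spread : ∀ {e s x t} → M π e ≡ false → M π x ≡ false → c (end e s) ≡ true →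
    end e s ≡ end x t → Pendant (end e (not s)) → Pendant (end x (not t))
  pendant-spread {e} {s} {x} {t} me mx p eq pend with star mx t
  ... | inj₂ u = OnlyAt-D⇒Pendant (trans (crossing t mx) (cong not (trans (cong c (sym eq)) p))) u
  ... | inj₁ u with u e s me eq
  ... | refl with side-unique eq
  ... | refl = pend

  -- In a star centred in P with several spokes, `δ (δ d)` may be another outer vertex than `d`;
  -- pendancy has to travel through the centre.
  pendant-δ : ∀ {d} → c d ≡ false → Pendant d → Pendant (δ (δ d))
  pendant-δ {d} cd pend = pendant-spread {link d} {not (linkSide d)} (link∉M d) (link∉M (δ d))
    (trans (c-δ d) (cong not cd)) (sym (link-end (δ d)))
    (subst Pendant (sym (trans (cong (end (link d)) (not-involutive _)) (link-end d))) pend)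

  -- The vertex representing the star of v: its centre, or the end in P if the star is one edge.
  opaque
    rep : V G → V G
    rep v with c v | pendant? v | pendant? (δ v)
    ... | true  | _     | yes _ = v
    ... | true  | _     | no _  = δ v
    ... | false | yes _ | _     = δ v
    ... | false | no _  | _     = v

    rep-P-pendant : ∀ {v} → c v ≡ true → Pendant (δ v) → rep v ≡ v
    rep-P-pendant {v} cv pend with c v | pendant? v | pendant? (δ v)
    ... | true | _ | yes _ = refl
    ... | true | _ | no ¬p = contradiction pend ¬p

    rep-P-inner : ∀ {v} → c v ≡ true → ¬ Pendant (δ v) → rep v ≡ δ v
    rep-P-inner {v} cv ¬pend with c v | pendant? v | pendant? (δ v)
    ... | true | _ | yes p = contradiction p ¬pend
    ... | true | _ | no _  = refl

    rep-D-pendant : ∀ {v} → c v ≡ false → Pendant v → rep v ≡ δ v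
    rep-D-pendant {v} cv pend with c v | pendant? v | pendant? (δ v)
    ... | false | yes _ | _ = refl
    ... | false | no ¬p | _ = contradiction pend ¬p

    rep-D-inner : ∀ {v} → c v ≡ false → ¬ Pendant v → rep v ≡ v
    rep-D-inner {v} cv ¬pend with c v | pendant? v | pendant? (δ v)
    ... | false | yes p | _ = contradiction p ¬pend
    ... | false | no _  | _ = refl

  δ≢ : ∀ v → δ v ≢ v
  δ≢ v eq = ≡not⇒≢ (c v) (trans (cong c (sym eq)) (c-δ v))

  c-δ-P : ∀ {v} → c v ≡ true → c (δ v) ≡ false
  c-δ-P {v} p = trans (c-δ v) (cong not p)

  c-δ-D : ∀ {v} → c v ≡ false → c (δ v) ≡ true
  c-δ-D {v} d = trans (c-δ v) (cong not d)

  rep-idem : ∀ v → rep (rep v) ≡ rep v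
  rep-idem v with c v in cv
  ... | true with pendant? (δ v)
  ...   | yes p = cong rep (rep-P-pendant cv p)
  ...   | no ¬p rewrite rep-P-inner cv ¬p = rep-D-inner (c-δ-P cv) ¬p
  rep-idem v | false with pendant? v
  ...   | yes p rewrite rep-D-pendant cv p = rep-P-pendant (c-δ-D cv) (pendant-δ cv p)
  ...   | no ¬p = cong rep (rep-D-inner cv ¬p)

  -- If the end in D is pendant, both ends are represented by the end in P. If not, `star` leaves
  -- `e` alone at its end in P, and both are represented by the end in D.
  rep-cross-P : ∀ {e} s → M π e ≡ false → c (end e s) ≡ true → rep (end e s) ≡ rep (end e (not s))
  rep-cross-P {e} s m cs with trans (crossing s m) (cong not cs) | pendant? (end e (not s))
  ... | cd | yes p = trans (rep-P-pendant cs (pendant-spread {e} {s} m (link∉M _) cs (sym (link-end _)) p)) (sym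
        (trans (rep-D-pendant cd p) same))
    where
    same : δ (end e (not s)) ≡ end e s
    same with p e (not s) refl
    ... | eq = trans (cong₂ (λ x t → end x (not t)) (sym eq) (side-unique (trans (cong (λ x → end x (linkSide (end e (not s)))) eq) (link-end (end e (not s)))))) (cong (end e) (not-involutive s))
  ... | cd | no ¬p with star m s
  ...   | inj₂ u = contradiction (OnlyAt-D⇒Pendant cd u) ¬p
  ...   | inj₁ u = trans (rep-P-inner cs (subst (¬_ ∘ Pendant) (sym same) ¬p)) (trans same (sym (rep-D-inner cd ¬p)))
    where
    same : δ (end e s) ≡ end e (not s)
    same with u (link (end e s)) (linkSide (end e s)) (link∉M _) (link-end _)
    ... | eq = cong₂ (λ x t → end x (not t)) eq (side-unique (trans (cong (λ x → end x (linkSide (end e s))) (sym eq)) (link-end (end e s))))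

  rep-cross : ∀ {e} s → M π e ≡ false → rep (end e (not s)) ≡ rep (end e s)
  rep-cross {e} s m with c (end e s) in cs
  ... | true  = sym (rep-cross-P s m cs)
  ... | false = trans (rep-cross-P (not s) m (trans (crossing s m) (cong not cs))) (cong (rep ∘ end e) (not-involutive s))

-- G is the 2-subdivision of the graph obtained by contracting the edges between D and P.
module Contraction (G : Graph) (crit : Critical G) (π : Pair G Any) where
  open Structure G crit π

  -- The fixed points of `rep` replace a quotient by the stars. A matching edge with both ends in
  -- one star becomes a loop.
  H : Graph
  H = record
    { V        = Σ[ v ∈ V G ] True (rep v ≟ⱽ v)
    ; E        = Σ[ e ∈ E G ] T (M π e)
    ; V-finite = Σ-finite (V-finite G) (λ v → T-finite ⌊ rep v ≟ⱽ v ⌋)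
    ; E-finite = Σ-finite (E-finite G) (λ e → T-finite (M π e))
    ; endpoint = λ { (e , _) s → rep (end e s) , fromWitness (rep-idem (end e s)) }
    }

  VH-≡ : {x y : V H} → proj₁ x ≡ proj₁ y → x ≡ y
  VH-≡ {x , p} {_ , q} refl = cong (x ,_) (T-irrelevant p q)

  EH-≡ : {x y : E H} → proj₁ x ≡ proj₁ y → x ≡ y
  EH-≡ {x , p} {_ , q} refl = cong (x ,_) (T-irrelevant p q)

  fixed : (h : V H) → rep (proj₁ h) ≡ proj₁ h
  fixed (v , k) = toWitness {a? = rep v ≟ⱽ v} k

  repᴴ : V G → V H
  repᴴ v = rep v , fromWitness (rep-idem v)

  c-E : (m : E H) (s : Bool) → c (end (proj₁ m) s) ≡ true
  c-E (e , m) s = M-ends π s (T⇒true m)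

  -- Together with `mateᴴ` this identifies the half-edges of `H` with the vertices of P, so a degree
  -- in `H` counts the vertices of P in a star.
  halfEdge-unique : ∀ {m s m′ s′} → end (proj₁ m) s ≡ end (proj₁ m′) s′ → _≡_ {A = E H × Bool} (m , s) (m′ , s′)
  halfEdge-unique {m} {s} {m′} {s′} eq
    with EH-≡ {m} {m′} (mate-unique π {s = s} {s′ = s′} (T⇒true (proj₂ m)) (T⇒true (proj₂ m′)) eq)
  ... | refl = cong (m ,_) (side-unique eq)

  mateᴴ : ∀ p → c p ≡ true → E H
  mateᴴ p cp = mateEdge p cp , true⇒T (mate∈M p cp)

  pendant-P : (h : V H) → c (proj₁ h) ≡ true → Pendant (δ (proj₁ h))
  pendant-P h ch = decidable-stable (pendant? _) (λ ¬p → δ≢ _ (trans (sym (rep-P-inner ch ¬p)) (fixed h)))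

  ¬pendant-D : (h : V H) → c (proj₁ h) ≡ false → ¬ Pendant (proj₁ h)
  ¬pendant-D h ch p = δ≢ _ (trans (sym (rep-D-pendant ch p)) (fixed h))

  -- A vertex of P is represented either by itself or by a vertex of D, so a representative in P
  -- stands for no other vertex of P.
  degree-P : (h : V H) → c (proj₁ h) ≡ true → degree H h ≡ 1
  degree-P h@(v , _) cv = degree≡1-intro H (mateᴴ v cv) (mateSide v cv)
    (VH-≡ (trans (cong rep (mate-end v cv)) (fixed h)))
    λ m s eq → halfEdge-unique (trans (at-v m s (cong proj₁ eq)) (sym (mate-end v cv)))
    where
    at-v : ∀ m s → rep (end (proj₁ m) s) ≡ v → end (proj₁ m) s ≡ v
    at-v m s eq with pendant? (δ (end (proj₁ m) s))
    ... | yes p = trans (sym (rep-P-pendant (c-E m s) p)) eq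
    ... | no ¬p = ⊥-elim (true≢false cv (trans (cong c (trans (sym eq) (rep-P-inner (c-E m s) ¬p))) (c-δ-P (c-E m s))))

  -- With a single half-edge all neighbours of `h` would coincide. Then `star` allows only one edge,
  -- since parallel ones would share both ends, and `h` would be pendant.
  degree-D : (h : V H) → c (proj₁ h) ≡ false → degree H h ≢ 1
  degree-D h@(v , _) cv deg = ¬pendant-D h cv pendant
    where
    at-h : ∀ {p} (cp : c p ≡ true) → rep p ≡ v → endpoint H (mateᴴ p cp) (mateSide p cp) ≡ h
    at-h cp eq = VH-≡ (trans (cong rep (mate-end _ cp)) eq)
    c-nbr : ∀ {e} s → end e s ≡ v → c (end e (not s)) ≡ true
    c-nbr s refl = trans (crossing s (D-edge s cv)) (cong not cv)
    rep-nbr : ∀ {e} s → end e s ≡ v → rep (end e (not s)) ≡ v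
    rep-nbr s refl = trans (rep-cross s (D-edge s cv)) (fixed h)
    nbr-unique : ∀ {e s x t} → end e s ≡ v → end x t ≡ v → end e (not s) ≡ end x (not t)
    nbr-unique {e} {s} {x} {t} eq eq′
      with degree≡1-elim H {e = mateᴴ _ (c-nbr s eq)} {mateSide _ (c-nbr s eq)} {mateᴴ _ (c-nbr t eq′)} {mateSide _ (c-nbr t eq′)}
             deg (at-h (c-nbr s eq) (rep-nbr s eq)) (at-h (c-nbr t eq′) (rep-nbr t eq′))
    ... | he = trans (sym (mate-end _ (c-nbr s eq)))
                 (trans (cong (λ { ((m , _) , r) → end m r }) he) (mate-end _ (c-nbr t eq′)))
    pendant : Pendant v
    pendant e s eq with star (D-edge s (trans (cong c eq) cv)) s
    ... | inj₁ u = sym (u (link v) (linkSide v) (link∉M v) (trans (link-end v) (sym eq)))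
    ... | inj₂ u = sym (u (link v) (not (linkSide v)) (link∉M v) (nbr-unique {s = linkSide v} {t = s} (link-end v) eq))

  leaf-P : (h : V H) → c (proj₁ h) ≡ true → Leaf H h
  leaf-P h ch = fromWitness (degree-P h ch)

  P-leaf : (h : V H) → Leaf H h → c (proj₁ h) ≡ true
  P-leaf h l with c (proj₁ h) in ch
  ... | true  = refl
  ... | false = contradiction (toWitness l) (degree-D h ch)

  D-nonLeaf : (h : V H) → NonLeaf H h → c (proj₁ h) ≡ false
  D-nonLeaf h n with c (proj₁ h) in ch
  ... | false = refl
  ... | true  = contradiction (degree-P h ch) (toWitnessFalse {a? = degree H h ≟ℕ 1} n)

  noIsolated : NoIsolatedVertex H
  noIsolated h@(v , _) with c v in cv
  ... | true  = degree-pos H (mateᴴ v cv) (mateSide v cv) (VH-≡ (trans (cong rep (mate-end v cv)) (fixed h)))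
  ... | false = degree-pos H (mateᴴ (δ v) (c-δ-D cv)) (mateSide (δ v) (c-δ-D cv))
      (VH-≡ (trans (cong rep (mate-end (δ v) _))
        (trans (rep-cross (linkSide v) (link∉M v)) (trans (cong rep (link-end v)) (fixed h)))))

  connected : Connected G → Connected H
  connected (pos , conn) = inhabited⇒card (V-finite H) (repᴴ (card⇒inhabited (V-finite G) pos))
    , λ u v → subst₂ (Star (Adjacent H)) (VH-≡ (fixed u)) (VH-≡ (fixed v)) (walk (conn (proj₁ u) (proj₁ v)))
    where
    step : ∀ {u v} → Adjacent G u v → Star (Adjacent H) (repᴴ u) (repᴴ v)
    step (e , s , refl , refl) with M π e in m
    ... | true  = ((e , true⇒T m) , s , refl , refl) ◅ ε
    ... | false = subst (Star (Adjacent H) _) (VH-≡ (sym (rep-cross s m))) ε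
    walk : ∀ {u v} → Star (Adjacent G) u v → Star (Adjacent H) (repᴴ u) (repᴴ v)
    walk ε = ε
    walk (a ◅ as) = step a ◅◅ walk as

  IsSpoke : V G → E G → Set
  IsSpoke p e = M π e ≡ false × ∃[ s ] end e s ≡ p

  isSpoke? : ∀ p e → Dec (IsSpoke p e)
  isSpoke? p e = (M π e Bool.≟ false) ×-dec any? Bool-finite (λ s → end e s ≟ⱽ p)

  -- These are the edges of the star centred at `p`; their number becomes the value of `α` at a
  -- leaf. `True` keeps the second component proof-irrelevant, as counting requires.
  Spoke : V G → Set
  Spoke p = Σ[ e ∈ E G ] True (isSpoke? p e)

  Spoke-finite : ∀ p → Finite (Spoke p)
  Spoke-finite p = Σ-finite (E-finite G) (λ e → T-finite ⌊ isSpoke? p e ⌋)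

  opaque
    spoke : ∀ {p} (x : Spoke p) → IsSpoke p (proj₁ x)
    spoke x = toWitness (proj₂ x)

  mkSpoke : ∀ {p e} → IsSpoke p e → Spoke p
  mkSpoke sp = _ , fromWitness sp

  rim : ∀ {p} → Spoke p → V G
  rim x = end (proj₁ x) (not (proj₁ (proj₂ (spoke x))))

  Spoke-≡ : ∀ {p} {x y : Spoke p} → proj₁ x ≡ proj₁ y → x ≡ y
  Spoke-≡ {x = x , p} {_ , q} refl = cong (x ,_) (T-irrelevant p q)

  α : LeafSet H → ℕ
  α ((p , _) , _) = Finite.card (Spoke-finite p)

  nth : (l : LeafSet H) → Fin (α l) → Spoke (proj₁ (proj₁ l))
  nth ((p , _) , _) = Inverse.from (Finite.enum (Spoke-finite p))

  nth-injective : ∀ l {i j} → nth l i ≡ nth l j → i ≡ j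
  nth-injective l {i} {j} eq = trans (sym (Inverse.strictlyInverseˡ enum i))
    (trans (cong (Inverse.to enum) eq) (Inverse.strictlyInverseˡ enum j))
    where enum = Finite.enum (Spoke-finite (proj₁ (proj₁ l)))

  nth-surjective : ∀ l x → ∃[ i ] nth l i ≡ x
  nth-surjective l x = Inverse.to enum x , Inverse.strictlyInverseʳ enum x
    where enum = Finite.enum (Spoke-finite (proj₁ (proj₁ l)))

  α-pos : ∀ l → 1 ≤ α l
  α-pos l@((p , _) , _) = inhabited⇒card (Spoke-finite p) (mkSpoke (link∉M p , linkSide p , link-end p))

  open 2-Subdivision H α using (Vertex; old; new; inner; copy; Edge; middle; toInner; toCopy; ends)

  toV : Vertex → V G
  toV (new (m , _) s) = end m s
  toV (old (inner (v , _) _)) = v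
  toV (old (copy l i)) = rim (nth l i)

  -- At a non-leaf, the half-edge is a vertex of P in a star centred in D, and its `link` is its
  -- only edge outside the matching. At a leaf, it is the centre of a star, and the copies run
  -- through the spokes.
  toE : Edge → E G
  toE (middle (m , _)) = m
  toE (toInner (m , _) s _) = link (end m s)
  toE (toCopy m s l i) = proj₁ (nth (endpoint H m s , l) i)

  c-rim : ∀ l i → c (rim (nth l i)) ≡ false
  c-rim l@(h , lf) i with spoke (nth l i)
  ... | m , s , eq = trans (crossing s m) (cong not (trans (cong c eq) (P-leaf h lf)))

  pendant-rim : ∀ l i → Pendant (rim (nth l i))
  pendant-rim l@(h@(p , _) , lf) i with spoke (nth l i)
  ... | m , s , eq = pendant-spread {link p} {linkSide p} (link∉M p) m
        (trans (cong c (link-end p)) (P-leaf h lf)) (trans (link-end p) (sym eq)) (pendant-P h (P-leaf h lf))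

  c-toV : ∀ x → c (toV x) ≡ Vⁿ H α x
  c-toV (new m s) = c-E m s
  c-toV (old (inner h n)) = D-nonLeaf h n
  c-toV (old (copy l i)) = c-rim l i

  spoke-hub : ∀ {p q e} → c p ≡ true → c q ≡ true → IsSpoke p e → IsSpoke q e → p ≡ q
  spoke-hub cp cq (m , s , refl) (_ , t , refl) = P-end-unique m cp cq

  rep-leaf : ∀ m s → Leaf H (endpoint H m s) → rep (end (proj₁ m) s) ≡ end (proj₁ m) s
  rep-leaf m s l with pendant? (δ (end (proj₁ m) s))
  ... | yes p = rep-P-pendant (c-E m s) p
  ... | no ¬p = contradiction (trans (cong c (rep-P-inner (c-E m s) ¬p)) (c-δ-P (c-E m s))) (true≢false (P-leaf (endpoint H m s) l))

  inner-nonLeaf : ∀ m s → NonLeaf H (endpoint H m s) → ¬ Pendant (δ (end (proj₁ m) s))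
  inner-nonLeaf m s n p = true≢false (trans (cong c (rep-P-pendant (c-E m s) p)) (c-E m s)) (D-nonLeaf (endpoint H m s) n)

  copy-≡ : ∀ {l l′ i i′} → rim (nth l i) ≡ rim (nth l′ i′) → copy l i ≡ copy l′ i′
  copy-≡ {l@(h@(p , k) , lf)} {l′@(h′@(p′ , k′) , lf′)} {i} {i′} eq = finish same-hub
    where
    same-edge : proj₁ (nth l i) ≡ proj₁ (nth l′ i′)
    same-edge = trans (pendant-rim l i (proj₁ (nth l i)) _ refl)
      (trans (cong link eq) (sym (pendant-rim l′ i′ (proj₁ (nth l′ i′)) _ refl)))
    same-hub : p ≡ p′
    same-hub = spoke-hub (P-leaf h lf) (P-leaf h′ lf′) (subst (IsSpoke p) same-edge (spoke (nth l i))) (spoke (nth l′ i′))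
    finish : p ≡ p′ → copy l i ≡ copy l′ i′
    finish refl with T-irrelevant k k′
    ... | refl with T-irrelevant lf lf′
    ... | refl = cong (copy l) (nth-injective l (Spoke-≡ same-edge))

  toV-injective : ∀ {x y} → toV x ≡ toV y → x ≡ y
  -- Equal vertices have equal colours, which excludes a new vertex against an old one.
  toV-injective {x} {y} eq with trans (sym (c-toV x)) (trans (cong c eq) (c-toV y))
  toV-injective {new m s} {new m′ s′} eq | _ = cong (λ { (m , s) → new m s }) (halfEdge-unique {m} {s} {m′} {s′} eq)
  toV-injective {old (inner h n)} {old (inner h′ n′)} eq | _ with VH-≡ {h} {h′} eq
  ... | refl = cong (old ∘ inner h) (T-irrelevant n n′)
  toV-injective {old (inner h n)} {old (copy l i)} eq | _ =
    contradiction (subst Pendant (sym eq) (pendant-rim l i)) (¬pendant-D h (D-nonLeaf h n))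
  toV-injective {old (copy l i)} {old (inner h n)} eq | _ =
    contradiction (subst Pendant eq (pendant-rim l i)) (¬pendant-D h (D-nonLeaf h n))
  toV-injective {old (copy l i)} {old (copy l′ i′)} eq | _ = cong old (copy-≡ eq)

  toV-surjective : ∀ v → ∃[ x ] toV x ≡ v
  toV-surjective v with c v in cv
  ... | true = new (mateᴴ v cv) (mateSide v cv) , mate-end v cv
  ... | false with pendant? v
  ...   | no ¬p = let h = v , fromWitness (rep-D-inner cv ¬p) in
                  old (inner h (fromWitnessFalse (degree-D h cv))) , refl
  ...   | yes p = old (copy l (proj₁ nth-i)) , rim≡
    where
    h : V H
    h = δ v , fromWitness (rep-P-pendant (c-δ-D cv) (pendant-δ cv p))
    l : LeafSet H
    l = h , leaf-P h (c-δ-D cv)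
    nth-i = nth-surjective l (mkSpoke (link∉M v , not (linkSide v) , refl))
    rim≡ : rim (nth l (proj₁ nth-i)) ≡ v
    rim≡ = trans (cong rim (proj₂ nth-i)) (trans (cong (λ s → end (link v) (not s)) (side-unique (proj₂ (proj₂ (spoke (mkSpoke {e = link v} _))))))
             (trans (cong (end (link v)) (not-involutive _)) (link-end v)))

  toE-hub : ∀ e s → (n : NonLeaf H (endpoint H e s)) → IsSpoke (end (proj₁ e) s) (toE (toInner e s n))
  toE-hub e s n = link∉M _ , linkSide _ , link-end _

  toE-hub′ : ∀ e s l i → IsSpoke (end (proj₁ e) s) (toE (toCopy e s l i))
  toE-hub′ e s l i = subst (λ p → IsSpoke p (toE (toCopy e s l i))) (rep-leaf e s l) (spoke (nth (endpoint H e s , l) i))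

  -- An edge outside the matching has only one end in P, by `spoke-hub`, and this end recovers the
  -- half-edge.
  toE-injective : ∀ {x y} → toE x ≡ toE y → x ≡ y
  toE-injective {middle m} {middle m′} eq = cong middle (EH-≡ eq)
  toE-injective {middle m} {toInner _ _ _} eq = ⊥-elim (true≢false (T⇒true (proj₂ m)) (trans (cong (M π) eq) (link∉M _)))
  toE-injective {toInner _ _ _} {middle m} eq = ⊥-elim (true≢false (T⇒true (proj₂ m)) (trans (cong (M π) (sym eq)) (link∉M _)))
  toE-injective {middle m} {toCopy e s l i} eq = ⊥-elim (true≢false (T⇒true (proj₂ m)) (trans (cong (M π) eq) (proj₁ (toE-hub′ e s l i))))
  toE-injective {toCopy e s l i} {middle m} eq = ⊥-elim (true≢false (T⇒true (proj₂ m)) (trans (cong (M π) (sym eq)) (proj₁ (toE-hub′ e s l i))))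
  toE-injective {toInner e s n} {toInner e′ s′ n′} eq
    with halfEdge-unique {e} {s} {e′} {s′} (spoke-hub (c-E e s) (c-E e′ s′) (subst (IsSpoke _) eq (toE-hub e s n)) (toE-hub e′ s′ n′))
  ... | refl = cong (toInner e s) (T-irrelevant n n′)
  toE-injective {toInner e s n} {toCopy e′ s′ l i} eq
    with halfEdge-unique {e} {s} {e′} {s′} (spoke-hub (c-E e s) (c-E e′ s′) (subst (IsSpoke _) eq (toE-hub e s n)) (toE-hub′ e′ s′ l i))
  ... | refl = ⊥-elim (true≢false (P-leaf (endpoint H e s) l) (D-nonLeaf (endpoint H e s) n))
  toE-injective {toCopy e s l i} {toInner e′ s′ n} eq
    with halfEdge-unique {e} {s} {e′} {s′} (spoke-hub (c-E e s) (c-E e′ s′) (subst (IsSpoke _) eq (toE-hub′ e s l i)) (toE-hub e′ s′ n))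
  ... | refl = ⊥-elim (true≢false (P-leaf (endpoint H e s) l) (D-nonLeaf (endpoint H e s) n))
  toE-injective {toCopy e s l i} {toCopy e′ s′ l′ i′} eq
    with halfEdge-unique {e} {s} {e′} {s′} (spoke-hub (c-E e s) (c-E e′ s′) (subst (IsSpoke _) eq (toE-hub′ e s l i)) (toE-hub′ e′ s′ l′ i′))
  ... | refl with T-irrelevant l l′
  ... | refl = cong (toCopy e s l) (nth-injective (endpoint H e s , l) (Spoke-≡ eq))

  toE-surjective : ∀ e → ∃[ x ] toE x ≡ e
  toE-surjective e with M π e in m
  ... | true = middle (e , true⇒T m) , refl
  ... | false with P-end e m
  ... | t , ct = through (mateᴴ (end e t) ct) (mateSide (end e t) ct) (mate-end (end e t) ct)
    where
    through : ∀ x s → end (proj₁ x) s ≡ end e t → ∃[ y ] toE y ≡ e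
    through x s eq with degree H (endpoint H x s) ≟ℕ 1
    ... | yes d = toCopy x s l (proj₁ i) , cong proj₁ (proj₂ i)
      where
      l = fromWitness d
      i = nth-surjective (endpoint H x s , l) (mkSpoke (m , t , trans (sym eq) (sym (rep-leaf x s l))))
    ... | no d = toInner x s n , found
      where
      n = fromWitnessFalse d
      found : link (end (proj₁ x) s) ≡ e
      found with star m t
      ... | inj₁ u = u (link (end (proj₁ x) s)) (linkSide _) (link∉M _) (trans (link-end _) eq)
      -- Alone at its end in D, `e` would make that end pendant; this spreads to the far end of the
      -- link, which is excluded at a non-leaf.
      ... | inj₂ u = contradiction (pendant-spread {e} {t} m (link∉M _) ct (trans (sym eq) (sym (link-end _)))
                       (OnlyAt-D⇒Pendant (trans (crossing t m) (cong not ct)) u)) (inner-nonLeaf x s n)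

  S₂≅G : S₂ H α ≅ G
  S₂≅G = record
    { V-iso = bijective⇒↔ toV toV-injective toV-surjective
    ; E-iso = bijective⇒↔ toE toE-injective toE-surjective
    ; preserves-ends = λ
        { (middle _) → inj₁ (λ _ → refl)
        ; x@(toInner m s n) → orient x (linkSide _) (sym (link-end _)) (rep-P-inner (c-E m s) (inner-nonLeaf m s n))
        ; x@(toCopy m s l i) → let sp = spoke (nth (endpoint H m s , l) i) in
            orient x (proj₁ (proj₂ sp)) (trans (sym (rep-leaf m s l)) (sym (proj₂ (proj₂ sp)))) refl
        }
    }
    where
    orient : ∀ x t → toV (ends x false) ≡ end (toE x) t → toV (ends x true) ≡ end (toE x) (not t) →
      (∀ s → toV (ends x s) ≡ end (toE x) s) ⊎ (∀ s → toV (ends x s) ≡ end (toE x) (not s))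
    orient x false p q = inj₁ λ { false → p ; true → q }
    orient x true  p q = inj₂ λ { false → p ; true → q }

-- Two different DP-pairs force degree two everywhere

TwoEdges : (G : Graph) → V G → Set
TwoEdges G v = ∃[ e₁ ] ∃[ e₂ ] (e₁ ≢ e₂ × Incident G e₁ v × Incident G e₂ v
                              × (∀ e → Incident G e v → e ≡ e₁ ⊎ e ≡ e₂))

twoEdges? : ∀ G v → Dec (TwoEdges G v)
twoEdges? G v = any? (E-finite G) λ e₁ → any? (E-finite G) λ e₂ →
  ¬? (e₁ ≟ᴱ e₂) ×-dec incident? e₁ ×-dec incident? e₂
  ×-dec all? (E-finite G) (λ e → incident? e →-dec ((e ≟ᴱ e₁) ⊎-dec (e ≟ᴱ e₂)))
  where
  _≟ᴱ_ = Finite._≟_ (E-finite G)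
  incident? : ∀ e → Dec (Incident G e v)
  incident? e = any? Bool-finite (λ s → Finite._≟_ (V-finite G) (endpoint G e s) v)

-- The invariant that propagates along edges from a vertex on which two DP-pairs differ.
Mixed : (G : Graph) → (V G → Bool) → (V G → Bool) → V G → Set
Mixed G c c′ v = c v ≢ c′ v
  ⊎ (TwoEdges G v × (∀ e s → endpoint G e s ≡ v → c (endpoint G e (not s)) ≢ c′ (endpoint G e (not s))))

Mixed-sym : ∀ {G c c′ v} → Mixed G c c′ v → Mixed G c′ c v
Mixed-sym (inj₁ ne) = inj₁ (≢-sym ne)
Mixed-sym (inj₂ (two , h)) = inj₂ (two , λ e s eq → ≢-sym (h e s eq))

module TwoPairs (G : Graph) (crit : Critical G) (πA πB : Pair G Any) where
  module A = Structure G crit πA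
  module B = Structure G crit πB
  open A using (end)

  differ : ∀ {v b} → A.c v ≡ b → B.c v ≡ not b → A.c v ≢ B.c v
  differ {b = b} p q eq = ≡not⇒≢ b (trans (sym p) (trans eq q))

  module _ {x : V G} (xD : A.c x ≡ false) (xP : B.c x ≡ true) where

    not-MA : ∀ {e} s → end e s ≡ x → M πA e ≡ false
    not-MA s eq = A.D-edge s (trans (cong A.c eq) xD)

    nbr-PA : ∀ {e} s → end e s ≡ x → A.c (end e (not s)) ≡ true
    nbr-PA s eq = trans (A.crossing s (not-MA s eq)) (cong not (trans (cong A.c eq) xD))

    -- The alternative in `star` would make the neighbour `y` across `e` pendant. But `y` is in P
    -- for `πA`, so it also has a matching edge of `πA`, which `e` is not.
    link-unique : ∀ {e} s → end e s ≡ x → M πB e ≡ false → e ≡ B.link x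
    link-unique {e} s eq m with B.star m s
    ... | inj₁ u = sym (u (B.link x) (B.linkSide x) (B.link∉M x) (trans (B.link-end x) (sym eq)))
    ... | inj₂ u = ⊥-elim (true≢false (A.mate∈M y yP) (trans (cong (M πA) (trans
            (pendant (A.mateEdge y yP) (A.mateSide y yP) (A.mate-end y yP)) (sym (pendant e (not s) refl)))) (not-MA s eq)))
      where
      y = end e (not s)
      yP = nbr-PA s eq
      pendant : B.Pendant y
      pendant = B.OnlyAt-D⇒Pendant (trans (B.crossing s m) (cong not (trans (cong B.c eq) xP))) u

    two : TwoEdges G x
    two = B.mateEdge x xP , B.link x
      , (λ eq → true≢false (B.mate∈M x xP) (trans (cong (M πB) eq) (B.link∉M x)))
      , (B.mateSide x xP , B.mate-end x xP) , (B.linkSide x , B.link-end x) , cover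
      where
      cover : ∀ e → Incident G e x → e ≡ B.mateEdge x xP ⊎ e ≡ B.link x
      cover e (s , eq) with M πB e in m
      ... | true  = inj₁ (mate-unique πB {s = s} {s′ = B.mateSide x xP} m (B.mate∈M x xP) (trans eq (sym (B.mate-end x xP))))
      ... | false = inj₂ (link-unique s eq m)

    -- All neighbours of `x` are in P for `πA`. Across an edge outside the matching of `πB` the
    -- neighbour is in D for `πB`. Across a matching edge of `πB` it is in P for both pairs, but
    -- they differ at its two neighbours, `x` and its mate in `πA`.
    nbr-mixed : ∀ e s → end e s ≡ x → Mixed G A.c B.c (end e (not s))
    nbr-mixed e s eq with M πB e in m
    ... | false = inj₁ (differ (nbr-PA s eq) (trans (B.crossing s m) (cong not (trans (cong B.c eq) xP))))
    ... | true  = inj₂ (two-a , nbrs)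
      where
      a = end e (not s)
      aP = nbr-PA s eq
      e-unique : ∀ y t → end y t ≡ a → M πA y ≡ false → y ≡ e
      e-unique y t eq′ my with A.star (not-MA s eq) s
      ... | inj₂ u = u y t my eq′
      -- `B.link x` is a second edge at `x` outside the matching of `πA`, so `e` is not alone there.
      ... | inj₁ u = ⊥-elim (true≢false m (trans (cong (M πB)
              (sym (u (B.link x) (B.linkSide x) (not-MA (B.linkSide x) (B.link-end x)) (trans (B.link-end x) (sym eq))))) (B.link∉M x)))
      two-a : TwoEdges G a
      two-a = e , A.mateEdge a aP
        , (λ eq′ → true≢false (A.mate∈M a aP) (trans (cong (M πA) (sym eq′)) (not-MA s eq)))
        , (not s , refl) , (A.mateSide a aP , A.mate-end a aP) , cover
        where
        cover : ∀ y → Incident G y a → y ≡ e ⊎ y ≡ A.mateEdge a aP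
        cover y (t , eq′) with M πA y in my
        ... | true  = inj₂ (mate-unique πA {s = t} {s′ = A.mateSide a aP} my (A.mate∈M a aP) (trans eq′ (sym (A.mate-end a aP))))
        ... | false = inj₁ (e-unique y t eq′ my)
      nbrs : ∀ y t → end y t ≡ a → A.c (end y (not t)) ≢ B.c (end y (not t))
      nbrs y t eq′ with M πA y in my
      ... | false with e-unique y t eq′ my
      ...   | refl = subst (λ v → A.c v ≢ B.c v) (sym back) (differ xD xP)
        where
        back : end e (not t) ≡ x
        back = trans (cong (end e ∘ not) (A.side-unique eq′)) (trans (cong (end e) (not-involutive s)) eq)
      nbrs y t eq′ | true with M πB y in my′
      ... | true  = ⊥-elim (true≢false my (trans (cong (M πA) (mate-unique πB {s = t} {s′ = not s} my′ m eq′)) (not-MA s eq)))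
      ... | false = differ (M-ends πA (not t) my)
                      (trans (B.crossing t my′) (cong not (trans (cong B.c eq′) (M-ends πB (not s) m))))

module _ (G : Graph) (crit : Critical G) (πA πB : Pair G Any) where
  private
    module AB = TwoPairs G crit πA πB
    module BA = TwoPairs G crit πB πA
    c = colour πA
    c′ = colour πB

    split : ∀ {v} → c v ≢ c′ v → (c v ≡ false × c′ v ≡ true) ⊎ (c′ v ≡ false × c v ≡ true)
    split {v} ne with c v | c′ v
    ... | false | true  = inj₁ (refl , refl)
    ... | true  | false = inj₂ (refl , refl)
    ... | false | false = contradiction refl ne
    ... | true  | true  = contradiction refl ne

    mixed-two : ∀ {v} → Mixed G c c′ v → TwoEdges G v
    mixed-two (inj₂ (two , _)) = two
    mixed-two (inj₁ ne) with split ne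
    ... | inj₁ (p , q) = AB.two p q
    ... | inj₂ (p , q) = BA.two p q

    mixed-step : ∀ {u v} → Adjacent G u v → Mixed G c c′ u → Mixed G c c′ v
    mixed-step (e , s , eq , refl) (inj₂ (_ , h)) = inj₁ (h e s eq)
    mixed-step (e , s , eq , refl) (inj₁ ne) with split ne
    ... | inj₁ (p , q) = AB.nbr-mixed p q e s eq
    ... | inj₂ (p , q) = Mixed-sym {G} {c′} {c} (BA.nbr-mixed p q e s eq)

    mixed-walk : ∀ {u v} → Star (Adjacent G) u v → Mixed G c c′ u → Mixed G c c′ v
    mixed-walk ε h = h
    mixed-walk (a ◅ as) h = mixed-walk as (mixed-step a h)

  differ⇒2-regular : Connected G → ∀ {x} → c x ≢ c′ x → ∀ v → TwoEdges G v
  differ⇒2-regular (_ , conn) {x} ne v = mixed-two (mixed-walk (conn x v) (inj₁ ne))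

module _ {A B : Set} where

  -- Off on `A`, on on `B`, unchanged elsewhere; `Long` alters both the colouring and the matching
  -- in this way.
  override : Dec A → Dec B → Bool → Bool
  override (yes _) _       _ = false
  override (no _)  (yes _) _ = true
  override (no _)  (no _)  b = b

  override-off : ∀ a? b? {b} → A → override a? b? b ≡ false
  override-off (yes _) _ _ = refl
  override-off (no ¬a) _ a = contradiction a ¬a

  override-on : ∀ a? b? {b} → ¬ A → B → override a? b? b ≡ true
  override-on (yes a) _       ¬a _ = contradiction a ¬a
  override-on (no _)  (yes _) _  _ = refl
  override-on (no _)  (no ¬b) _  b = contradiction b ¬b

  override-true : ∀ a? b? {b} → ¬ A → b ≡ true → override a? b? b ≡ true
  override-true (yes a) _       ¬a _  = contradiction a ¬a
  override-true (no _)  (yes _) _  _  = refl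
  override-true (no _)  (no _)  _  eq = eq

  override-false : ∀ a? b? {b} → ¬ B → b ≡ false → override a? b? b ≡ false
  override-false (yes _) _       _  _  = refl
  override-false (no _)  (yes b) ¬b _  = contradiction b ¬b
  override-false (no _)  (no _)  _  eq = eq

  override-elim : ∀ a? b? {b} → override a? b? b ≡ true → B ⊎ (b ≡ true × ¬ A)
  override-elim (no _)  (yes b) _  = inj₁ b
  override-elim (no ¬a) (no _)  eq = inj₂ (eq , ¬a)

-- 2-regular critical graphs are cycles of length 3, 6 or 9

module Regular (G : Graph) (crit : Critical G) (π : Pair G Any) (two : ∀ v → TwoEdges G v) where
  open Structure G crit π

  ¬pendant : ∀ v → ¬ Pendant v
  ¬pendant v p with two v
  ... | e₁ , e₂ , ne , (s , eq) , (t , eq′) , _ = ne (trans (p e₁ s eq) (sym (p e₂ t eq′)))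

  -- No vertex is pendant, so every star is centred in D and each vertex of P lies on just one
  -- spoke.
  link-unique : ∀ {e} s → c (end e s) ≡ true → M π e ≡ false → link (end e s) ≡ e
  link-unique {e} s cs m with star m s
  ... | inj₁ u = u _ (linkSide (end e s)) (link∉M _) (link-end _)
  ... | inj₂ u = contradiction (OnlyAt-D⇒Pendant (trans (crossing s m) (cong not cs)) u) (¬pendant _)

  δ-end : ∀ {e} s → c (end e s) ≡ true → M π e ≡ false → δ (end e s) ≡ end e (not s)
  δ-end {e} s cs m = trans (cong (λ t → end (link (end e s)) (not t)) side)
                           (cong (λ x → end x (not s)) (link-unique s cs m))
    where
    side : linkSide (end e s) ≡ s
    side = side-unique (trans (link-end (end e s)) (cong (λ x → end x s) (sym (link-unique s cs m))))

  link-injective : ∀ {p q} → c p ≡ true → c q ≡ true → link p ≡ link q → p ≡ q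
  link-injective {p} {q} cp cq eq = trans (sym (link-end p)) (trans
    (P-end-unique (link∉M p) (trans (cong c (link-end p)) cp) (trans (cong c back) cq)) back)
    where
    back : end (link p) (linkSide q) ≡ q
    back = trans (cong (λ x → end x (linkSide q)) eq) (link-end q)

  Pv : Set
  Pv = Σ[ v ∈ V G ] c v ≡ true

  Pv-≡ : {x y : Pv} → proj₁ x ≡ proj₁ y → x ≡ y
  Pv-≡ {x , p} {_ , q} refl = cong (x ,_) (uip p q)

  mt : Pv → E G
  mt (v , cv) = mateEdge v cv

  lk : Pv → E G
  lk (v , _) = link v

  opaque
    μ : Pv → Pv
    μ (v , cv) = end (mateEdge v cv) (not (mateSide v cv)) , M-ends π _ (mate∈M v cv)

    μ-mate : ∀ v cv → end (mateEdge v cv) (not (mateSide v cv)) ≡ proj₁ (μ (v , cv))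
    μ-mate v cv = refl

  mt-unique : ∀ (x : Pv) {e} s → M π e ≡ true → end e s ≡ proj₁ x → mt x ≡ e
  mt-unique (v , cv) s m eq = mate-unique π {s = mateSide v cv} {s′ = s} (mate∈M v cv) m (trans (mate-end v cv) (sym eq))

  μ-end : ∀ (x : Pv) {e} s → M π e ≡ true → end e s ≡ proj₁ x → proj₁ (μ x) ≡ end e (not s)
  μ-end x@(v , cv) {e} s m eq with mt-unique x s m eq
  ... | refl = trans (sym (μ-mate v cv)) (cong (end e ∘ not) (side-unique (trans (mate-end v cv) (sym eq))))

  mt-μ : ∀ x → mt (μ x) ≡ mt x
  mt-μ x@(v , cv) = mt-unique (μ x) (not (mateSide v cv)) (mate∈M v cv) (μ-mate v cv)

  μ-involutive : ∀ x → μ (μ x) ≡ x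
  μ-involutive x@(v , cv) = Pv-≡ (trans (μ-end (μ x) (not (mateSide v cv)) (mate∈M v cv) (μ-mate v cv))
    (trans (cong (end (mateEdge v cv)) (not-involutive _)) (mate-end v cv)))

  μ-≢ : ∀ x → x ≢ μ x
  μ-≢ x@(v , cv) eq = ≡not⇒≢ _ (side-unique (trans (mate-end v cv) (trans (cong proj₁ eq) (sym (μ-mate v cv)))))

  mt-injective : ∀ x y → mt x ≡ mt y → x ≡ y ⊎ x ≡ μ y
  mt-injective x@(v , cv) y@(w , cw) eq with ≡-or-≡not (mateSide w cw) (mateSide v cv)
  ... | inj₁ s = inj₁ (Pv-≡ (trans (sym (mate-end v cv)) (trans (cong₂ end eq s) (mate-end w cw))))
  ... | inj₂ s = inj₂ (Pv-≡ (trans (sym (mate-end v cv)) (trans (cong₂ end eq s) (μ-mate w cw))))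

  private
    other : ∀ {v e} → Incident G e v → ∃[ x ] (x ≢ e × Incident G x v × (∀ y → Incident G y v → y ≡ e ⊎ y ≡ x))
    other {v} {e} inc with two v
    ... | e₁ , e₂ , ne , i₁ , i₂ , cover with cover e inc
    ...   | inj₁ refl = e₂ , ≢-sym ne , i₂ , cover
    ...   | inj₂ refl = e₁ , ne , i₁ , λ y i → [ inj₂ , inj₁ ]′ (cover y i)

    -- The vertex `δ x` of D has two edges, and their ends in P are distinct because a vertex of P
    -- has only one edge outside the matching.
    sibling : ∀ x → ∃[ y ] (lk y ≢ lk x × δ (proj₁ y) ≡ δ (proj₁ x)
                          × (∀ z → δ (proj₁ z) ≡ δ (proj₁ x) → z ≡ x ⊎ z ≡ y))
    sibling x@(v , cv) with other {δ v} {link v} (not (linkSide v) , refl)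
    ... | e , ne , (s , eq) , cover = y
        , (λ eq′ → ne (trans (sym lk-y) eq′))
        , trans (δ-end (not s) cy m) (trans (cong (end e) (not-involutive s)) eq)
        , λ z@(w , cw) eq′ → [ (λ h → inj₁ (Pv-≡ (link-injective cw cv h)))
                             , (λ h → inj₂ (Pv-≡ (link-injective cw cy (trans h (sym lk-y))))) ]′
                             (cover (link w) (not (linkSide w) , eq′))
      where
      m : M π e ≡ false
      m = D-edge s (trans (cong c eq) (c-δ-P cv))
      cy : c (end e (not s)) ≡ true
      cy = trans (crossing s m) (cong not (trans (cong c eq) (c-δ-P cv)))
      y : Pv
      y = end e (not s) , cy
      lk-y : link (end e (not s)) ≡ e
      lk-y = link-unique (not s) cy m

  opaque
    σ : Pv → Pv
    σ x = proj₁ (sibling x)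

    σ-≢ : ∀ x → σ x ≢ x
    σ-≢ x eq = proj₁ (proj₂ (sibling x)) (cong lk eq)

    δ-σ : ∀ x → δ (proj₁ (σ x)) ≡ δ (proj₁ x)
    δ-σ x = proj₁ (proj₂ (proj₂ (sibling x)))

    δ-injective : ∀ z x → δ (proj₁ z) ≡ δ (proj₁ x) → z ≡ x ⊎ z ≡ σ x
    δ-injective z x = proj₂ (proj₂ (proj₂ (sibling x))) z

  σ-involutive : ∀ x → σ (σ x) ≡ x
  σ-involutive x with δ-injective (σ (σ x)) x (trans (δ-σ (σ x)) (δ-σ x))
  ... | inj₁ eq = eq
  ... | inj₂ eq = contradiction eq (σ-≢ (σ x))

  μ-injective : ∀ {x y} → μ x ≡ μ y → x ≡ y
  μ-injective {x} {y} eq = trans (sym (μ-involutive x)) (trans (cong μ eq) (μ-involutive y))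

  module Walk (p₀ : Pv) where

    -- One step crosses a matching edge and then a vertex of D. Block `i` consists of `δ (p i)`,
    -- `p i` and `μ (p i)`, in this order.
    p : ℕ → Pv
    p zero    = p₀
    p (suc i) = σ (μ (p i))

    σ-p : ∀ i → σ (p (suc i)) ≡ μ (p i)
    σ-p i = σ-involutive (μ (p i))

    -- The orbits of p₀ and μ p₀ under σμ are disjoint: a relation p i ≡ μ (p j) can be
    -- moved inwards until it contradicts that μ and σ have no fixed points.
    separate′ : ∀ t j → p (t + j) ≢ μ (p j)
    separate′ zero          j eq = μ-≢ (p j) eq
    separate′ (suc zero)    j eq = σ-≢ (μ (p j)) eq
    separate′ (suc (suc t)) j eq = separate′ t (suc j)
      (trans (cong p (ℕ.+-suc t j)) (trans (sym (μ-involutive _))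
        (cong μ (trans (sym (σ-p (suc t + j))) (cong σ eq)))))

    separate : ∀ i j → p i ≢ μ (p j)
    separate i j eq with ℕ.≤-total j i
    ... | inj₁ j≤i = separate′ (i ∸ j) j (trans (cong p (ℕ.m∸n+n≡m j≤i)) eq)
    ... | inj₂ i≤j = separate′ (j ∸ i) i (trans (cong p (ℕ.m∸n+n≡m i≤j)) (trans (sym (μ-involutive _)) (cong μ (sym eq))))

    p-suc-injective : ∀ {i j} → p (suc i) ≡ p (suc j) → p i ≡ p j
    p-suc-injective {i} {j} eq = μ-injective (trans (sym (σ-p i)) (trans (cong σ eq) (σ-p j)))

    -- Steps are injective, so a repetition can be pulled back to the start.
    p-shift : ∀ i t → p (i + t) ≡ p i → p t ≡ p 0
    p-shift zero    t eq = eq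
    p-shift (suc i) t eq = p-shift i t (p-suc-injective {i + t} {i} eq)

    p-injective< : ∀ {k} → (∀ t → 0 < t → t < k → p t ≢ p 0) → ∀ {i j} → i < j → j < k → p i ≢ p j
    p-injective< prim {i} {j} i<j j<k eq = prim (j ∸ i) (ℕ.m<n⇒0<n∸m i<j) (ℕ.≤-<-trans (ℕ.m∸n≤m j i) j<k)
      (p-shift i _ (trans (cong p (ℕ.m+[n∸m]≡n (ℕ.<⇒≤ i<j))) (sym eq)))

    data Visited : V G → Set where
      atδ : ∀ i → Visited (δ (proj₁ (p i)))
      atp : ∀ i → Visited (proj₁ (p i))
      atμ : ∀ i → Visited (proj₁ (μ (p i)))

    module Closed (k′ : ℕ) (closed : p (suc k′) ≡ p 0) (minimal : ∀ t → 0 < t → t < suc k′ → p t ≢ p 0) where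
      k = suc k′

      wrap : ∀ i → ∃[ j ] p i ≡ p (toℕ {k} j)
      wrap zero = zero , refl
      wrap (suc i) with wrap i
      ... | j , eq with suc (toℕ j) <? k
      ...   | yes lt = fromℕ< lt , trans (cong (σ ∘ μ) eq) (cong p (sym (Fin.toℕ-fromℕ< lt)))
      ...   | no ¬lt = zero , trans (cong (σ ∘ μ) eq) (trans (cong p (ℕ.≤-antisym (Fin.toℕ<n j) (ℕ.≮⇒≥ ¬lt))) closed)

      σ-back : ∀ i → ∃[ j ] σ (p i) ≡ μ (p j)
      -- Block 0 is preceded by the last block.
      σ-back zero    = k′ , trans (cong σ (sym closed)) (σ-p k′)
      σ-back (suc i) = i , σ-p i

      p-injective : ∀ {i j : Fin k} → p (toℕ i) ≡ p (toℕ j) → i ≡ j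
      p-injective {i} {j} eq with ℕ.<-cmp (toℕ i) (toℕ j)
      ... | tri< lt _ _ = contradiction eq (p-injective< minimal lt (Fin.toℕ<n j))
      ... | tri≈ _ e _  = Fin.toℕ-injective e
      ... | tri> _ _ gt = contradiction (sym eq) (p-injective< minimal gt (Fin.toℕ<n i))

      -- The blocks contain all neighbours of their vertices, so in a connected graph they exhaust
      -- it.
      visited-step : ∀ {u v} → Adjacent G u v → Visited u → Visited v
      visited-step (e , s , refl , refl) vis = go (M π e) refl vis
        where
        visited-P : ∀ {v} → c v ≡ true → Visited v → ∃[ i ] (v ≡ proj₁ (p i) ⊎ v ≡ proj₁ (μ (p i)))
        visited-P cv (atδ i) = contradiction (c-δ-P (proj₂ (p i))) (true≢false cv)
        visited-P cv (atp i) = i , inj₁ refl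
        visited-P cv (atμ i) = i , inj₂ refl
        visited-D : ∀ {v} → c v ≡ false → Visited v → ∃[ i ] v ≡ δ (proj₁ (p i))
        visited-D cv (atδ i) = i , refl
        visited-D cv (atp i) = contradiction cv (true≢false (proj₂ (p i)))
        visited-D cv (atμ i) = contradiction cv (true≢false (proj₂ (μ (p i))))
        go : ∀ b → M π e ≡ b → Visited (end e s) → Visited (end e (not s))
        go true m vis with visited-P (M-ends π s m) vis
        ... | i , inj₁ eq = subst Visited (μ-end (p i) s m eq) (atμ i)
        ... | i , inj₂ eq = subst Visited (trans (cong proj₁ (sym (μ-involutive (p i)))) (μ-end (μ (p i)) s m eq)) (atp i)
        go false m vis with c (end e s) in cs
        ... | true with visited-P cs vis
        ...   | i , inj₁ eq = subst Visited (trans (cong δ (sym eq)) (δ-end s cs m)) (atδ i)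
        ...   | i , inj₂ eq = subst Visited (trans (δ-σ (μ (p i))) (trans (cong δ (sym eq)) (δ-end s cs m))) (atδ (suc i))
        go false m vis | false with visited-D cs vis
        ...   | i , eq with δ-injective (end e (not s) , cv) (p i)
                              (trans (δ-end (not s) cv m) (trans (cong (end e) (not-involutive s)) eq))
          where
          cv : c (end e (not s)) ≡ true
          cv = trans (crossing s m) (cong not cs)
        ...     | inj₁ eq′ = subst Visited (sym (cong proj₁ eq′)) (atp i)
        ...     | inj₂ eq′ with σ-back i
        ...       | j , eq″ = subst Visited (sym (cong proj₁ (trans eq′ eq″))) (atμ j)

      module _ (conn : Connected G) where

        visited : ∀ v → Visited v
        visited v = walk (proj₂ conn (proj₁ p₀) v) (atp 0)
          where
          walk : ∀ {u v} → Star (Adjacent G) u v → Visited u → Visited v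
          walk ε h = h
          walk (a ◅ as) h = walk as (visited-step a h)

        -- Position `3i + r` of the cycle is entry `r` of block `i`; `remQuot 3` converts between
        -- the two.
        vertexAt : Fin k × Fin 3 → V G
        vertexAt (i , 0F) = δ (proj₁ (p (toℕ i)))
        vertexAt (i , 1F) = proj₁ (p (toℕ i))
        vertexAt (i , 2F) = proj₁ (μ (p (toℕ i)))

        edgeAt : Fin k × Fin 3 → E G
        edgeAt (i , 0F) = lk (p (toℕ i))
        edgeAt (i , 1F) = mt (p (toℕ i))
        edgeAt (i , 2F) = lk (μ (p (toℕ i)))

        private
          lk-injective : ∀ {x y} → lk x ≡ lk y → x ≡ y
          lk-injective {_ , cx} {_ , cy} eq = Pv-≡ (link-injective cx cy eq)

          D≢P : ∀ x y → δ (proj₁ x) ≢ proj₁ y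
          D≢P (_ , cx) (_ , cy) eq = true≢false cy (trans (cong c (sym eq)) (c-δ-P cx))

          lk≢mt : ∀ x y → lk x ≢ mt y
          lk≢mt (v , _) (w , cw) eq = true≢false (mate∈M w cw) (trans (cong (M π) (sym eq)) (link∉M v))

          p-δ-injective : ∀ {i j : Fin k} → δ (proj₁ (p (toℕ i))) ≡ δ (proj₁ (p (toℕ j))) → i ≡ j
          p-δ-injective {i} {j} eq with δ-injective (p (toℕ i)) (p (toℕ j)) eq
          ... | inj₁ h = p-injective h
          -- The sibling of `p j` has the form `μ (p _)`, and `separate` keeps it off the orbit of
          -- `p₀`.
          ... | inj₂ h = contradiction (trans h (proj₂ (σ-back (toℕ j)))) (separate (toℕ i) (proj₁ (σ-back (toℕ j))))

        vertexAt-injective : ∀ x y → vertexAt x ≡ vertexAt y → x ≡ y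
        vertexAt-injective (i , 0F) (j , 0F) eq = cong (_, 0F) (p-δ-injective eq)
        vertexAt-injective (i , 0F) (j , 1F) eq = contradiction eq (D≢P (p (toℕ i)) (p (toℕ j)))
        vertexAt-injective (i , 0F) (j , 2F) eq = contradiction eq (D≢P (p (toℕ i)) (μ (p (toℕ j))))
        vertexAt-injective (i , 1F) (j , 0F) eq = contradiction (sym eq) (D≢P (p (toℕ j)) (p (toℕ i)))
        vertexAt-injective (i , 1F) (j , 1F) eq = cong (_, 1F) (p-injective (Pv-≡ eq))
        vertexAt-injective (i , 1F) (j , 2F) eq = contradiction (Pv-≡ eq) (separate (toℕ i) (toℕ j))
        vertexAt-injective (i , 2F) (j , 0F) eq = contradiction (sym eq) (D≢P (p (toℕ j)) (μ (p (toℕ i))))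
        vertexAt-injective (i , 2F) (j , 1F) eq = contradiction (Pv-≡ (sym eq)) (separate (toℕ j) (toℕ i))
        vertexAt-injective (i , 2F) (j , 2F) eq = cong (_, 2F) (p-injective (μ-injective (Pv-≡ eq)))

        vertexAt-surjective : ∀ v → ∃[ x ] vertexAt x ≡ v
        vertexAt-surjective v with visited v
        ... | atδ i = (proj₁ (wrap i) , 0F) , cong (δ ∘ proj₁) (sym (proj₂ (wrap i)))
        ... | atp i = (proj₁ (wrap i) , 1F) , cong proj₁ (sym (proj₂ (wrap i)))
        ... | atμ i = (proj₁ (wrap i) , 2F) , cong (proj₁ ∘ μ) (sym (proj₂ (wrap i)))

        edgeAt-injective : ∀ x y → edgeAt x ≡ edgeAt y → x ≡ y
        edgeAt-injective (i , 0F) (j , 0F) eq = cong (_, 0F) (p-injective (lk-injective eq))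
        edgeAt-injective (i , 0F) (j , 1F) eq = contradiction eq (lk≢mt (p (toℕ i)) (p (toℕ j)))
        edgeAt-injective (i , 0F) (j , 2F) eq = contradiction (lk-injective eq) (separate (toℕ i) (toℕ j))
        edgeAt-injective (i , 1F) (j , 0F) eq = contradiction (sym eq) (lk≢mt (p (toℕ j)) (p (toℕ i)))
        edgeAt-injective (i , 1F) (j , 1F) eq with mt-injective (p (toℕ i)) (p (toℕ j)) eq
        ... | inj₁ h = cong (_, 1F) (p-injective h)
        ... | inj₂ h = contradiction h (separate (toℕ i) (toℕ j))
        edgeAt-injective (i , 1F) (j , 2F) eq = contradiction (sym eq) (lk≢mt (μ (p (toℕ j))) (p (toℕ i)))
        edgeAt-injective (i , 2F) (j , 0F) eq = contradiction (lk-injective (sym eq)) (separate (toℕ j) (toℕ i))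
        edgeAt-injective (i , 2F) (j , 1F) eq = contradiction eq (lk≢mt (μ (p (toℕ i))) (p (toℕ j)))
        edgeAt-injective (i , 2F) (j , 2F) eq = cong (_, 2F) (p-injective (μ-injective (lk-injective eq)))

        edgeAt-surjective : ∀ e → ∃[ x ] edgeAt x ≡ e
        edgeAt-surjective e with M π e in m
        ... | true with vertexAt-surjective (end e false)
        ...   | (i , 0F) , eq = contradiction (c-δ-P (proj₂ (p (toℕ i)))) (true≢false (trans (cong c eq) (M-ends π false m)))
        ...   | (i , 1F) , eq = (i , 1F) , mt-unique (p (toℕ i)) false m (sym eq)
        ...   | (i , 2F) , eq = (i , 1F) , trans (sym (mt-μ (p (toℕ i)))) (mt-unique (μ (p (toℕ i))) false m (sym eq))
        edgeAt-surjective e | false with P-end e m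
        ... | t , ct with vertexAt-surjective (end e t)
        ...   | (i , 0F) , eq = contradiction (c-δ-P (proj₂ (p (toℕ i)))) (true≢false (trans (cong c eq) ct))
        ...   | (i , 1F) , eq = (i , 0F) , trans (cong link eq) (link-unique t ct m)
        ...   | (i , 2F) , eq = (i , 2F) , trans (cong link eq) (link-unique t ct m)

        Joins : E G → V G → V G → Set
        Joins e u v = ∃[ t ] (u ≡ end e t × v ≡ end e (not t))

        joins₀ : ∀ i → Joins (lk (p i)) (δ (proj₁ (p i))) (proj₁ (p i))
        joins₀ i = not (linkSide v) , refl , sym (trans (cong (end (link v)) (not-involutive _)) (link-end v))
          where v = proj₁ (p i)

        joins₁ : ∀ i → Joins (mt (p i)) (proj₁ (p i)) (proj₁ (μ (p i)))
        joins₁ i = _ , sym (mate-end _ (proj₂ (p i))) , sym (μ-mate _ (proj₂ (p i)))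

        joins₂ : ∀ i → Joins (lk (μ (p i))) (proj₁ (μ (p i))) (δ (proj₁ (p (suc i))))
        joins₂ i = _ , sym (link-end _) , δ-σ (μ (p i))

        joinsLast : Joins (lk (μ (p k′))) (proj₁ (μ (p k′))) (δ (proj₁ (p 0)))
        joinsLast = subst (λ x → Joins (lk (μ (p k′))) (proj₁ (μ (p k′))) (δ (proj₁ x))) closed (joins₂ k′)

        -- Kept as a hypothesis of `cycle≅` because it is checked position by position once `k` is
        -- 1, 2 or 3 and `mod` computes.
        Joins-mod : Set
        Joins-mod = ∀ (i : Fin (k * 3)) → Joins (edgeAt (remQuot 3 i)) (vertexAt (remQuot 3 i)) (vertexAt (remQuot 3 (suc (toℕ i) mod (k * 3))))

        remQuot-injective : ∀ {i j : Fin (k * 3)} → remQuot {k} 3 i ≡ remQuot 3 j → i ≡ j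
        remQuot-injective {i} {j} eq = trans (sym (Fin.combine-remQuot {k} 3 i))
          (trans (cong (uncurry combine) eq) (Fin.combine-remQuot {k} 3 j))

        cycle≅ : Joins-mod → cycle (k * 3) ≅ G
        cycle≅ joins = record
          { V-iso = bijective⇒↔ (vertexAt ∘ remQuot 3) (λ eq → remQuot-injective (vertexAt-injective _ _ eq))
              (λ v → let (x , eq) = vertexAt-surjective v in
                combine (proj₁ x) (proj₂ x) , trans (cong vertexAt (Fin.remQuot-combine (proj₁ x) (proj₂ x))) eq)
          ; E-iso = bijective⇒↔ (edgeAt ∘ remQuot 3) (λ eq → remQuot-injective (edgeAt-injective _ _ eq))
              (λ e → let (x , eq) = edgeAt-surjective e in
                combine (proj₁ x) (proj₂ x) , trans (cong edgeAt (Fin.remQuot-combine (proj₁ x) (proj₂ x))) eq)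
          ; preserves-ends = λ i → orient i (joins i)
          }
          where
          orient : ∀ i → Joins (edgeAt (remQuot 3 i)) (vertexAt (remQuot 3 i)) (vertexAt (remQuot 3 (suc (toℕ i) mod (k * 3)))) → _
          orient i (false , a , b) = inj₁ λ { false → a ; true → b }
          orient i (true  , a , b) = inj₂ λ { false → a ; true → b }

    -- A fourth block: D PP D PP D PP D PP is recoloured to D PP DD PP DD PP D, which
    -- creates an edge inside D.
    module Long (p₁≢p₀ : p 1 ≢ p 0) (p₂≢p₀ : p 2 ≢ p 0) (p₃≢p₀ : p 3 ≢ p 0) where

      P₁ P₂ P₃ Q₁ Q₂ Q₃ D₂ D₃ : V G
      P₁ = proj₁ (p 1)
      P₂ = proj₁ (p 2)
      P₃ = proj₁ (p 3)
      Q₁ = proj₁ (μ (p 1))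
      Q₂ = proj₁ (μ (p 2))
      Q₃ = proj₁ (μ (p 3))
      D₂ = δ P₂
      D₃ = δ P₃

      private
        P≢ : ∀ i t → p t ≢ p 0 → p (i + t) ≢ p i
        P≢ i t ne eq = ne (p-shift i t eq)

        Q≢ : ∀ i t → p t ≢ p 0 → μ (p (i + t)) ≢ μ (p i)
        Q≢ i t ne eq = P≢ i t ne (μ-injective eq)

        δQ₁ : δ Q₁ ≡ D₂
        δQ₁ = sym (δ-σ (μ (p 1)))

        δQ₂ : δ Q₂ ≡ D₃
        δQ₂ = sym (δ-σ (μ (p 2)))

        c-P : (x : Pv) → c (proj₁ x) ≡ true
        c-P = proj₂

      -- Along `δ P₁`, `P₁`, `Q₁`, `D₂`, `P₂`, `Q₂`, `D₃`, `P₃`, `Q₃` the new colours are D D P P D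
      -- D P P D. The new matched pairs are `Q₁` with `D₂` and `D₃` with `P₃`, and the three old
      -- matching edges are dropped.
      data ToD : V G → Set where
        P₁∈ : ToD P₁
        P₂∈ : ToD P₂
        Q₂∈ : ToD Q₂
        Q₃∈ : ToD Q₃

      data ToP : V G → Set where
        D₂∈ : ToP D₂
        D₃∈ : ToP D₃

      data Off : E G → Set where
        m₁∈ : Off (mt (p 1))
        m₂∈ : Off (mt (p 2))
        m₃∈ : Off (mt (p 3))

      data On : E G → Set where
        l₂∈ : On (lk (μ (p 1)))
        l₃∈ : On (lk (p 3))

      opaque
        toD? : ∀ v → Dec (ToD v)
        toD? v = map′ (λ { (inj₁ refl) → P₁∈ ; (inj₂ (inj₁ refl)) → P₂∈ ; (inj₂ (inj₂ (inj₁ refl))) → Q₂∈ ; (inj₂ (inj₂ (inj₂ refl))) → Q₃∈ })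
          (λ { P₁∈ → inj₁ refl ; P₂∈ → inj₂ (inj₁ refl) ; Q₂∈ → inj₂ (inj₂ (inj₁ refl)) ; Q₃∈ → inj₂ (inj₂ (inj₂ refl)) })
          ((v ≟ⱽ P₁) ⊎-dec (v ≟ⱽ P₂) ⊎-dec (v ≟ⱽ Q₂) ⊎-dec (v ≟ⱽ Q₃))

        toP? : ∀ v → Dec (ToP v)
        toP? v = map′ (λ { (inj₁ refl) → D₂∈ ; (inj₂ refl) → D₃∈ }) (λ { D₂∈ → inj₁ refl ; D₃∈ → inj₂ refl })
          ((v ≟ⱽ D₂) ⊎-dec (v ≟ⱽ D₃))

        off? : ∀ e → Dec (Off e)
        off? e = map′ (λ { (inj₁ refl) → m₁∈ ; (inj₂ (inj₁ refl)) → m₂∈ ; (inj₂ (inj₂ refl)) → m₃∈ })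
          (λ { m₁∈ → inj₁ refl ; m₂∈ → inj₂ (inj₁ refl) ; m₃∈ → inj₂ (inj₂ refl) })
          ((e ≟ᴱ mt (p 1)) ⊎-dec (e ≟ᴱ mt (p 2)) ⊎-dec (e ≟ᴱ mt (p 3)))

        on? : ∀ e → Dec (On e)
        on? e = map′ (λ { (inj₁ refl) → l₂∈ ; (inj₂ refl) → l₃∈ }) (λ { l₂∈ → inj₁ refl ; l₃∈ → inj₂ refl })
          ((e ≟ᴱ lk (μ (p 1))) ⊎-dec (e ≟ᴱ lk (p 3)))

      private
        ToD-P : ∀ {v} → ToD v → c v ≡ true
        ToD-P P₁∈ = c-P (p 1)
        ToD-P P₂∈ = c-P (p 2)
        ToD-P Q₂∈ = c-P (μ (p 2))
        ToD-P Q₃∈ = c-P (μ (p 3))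

        ToP-D : ∀ {v} → ToP v → c v ≡ false
        ToP-D D₂∈ = c-δ-P (c-P (p 2))
        ToP-D D₃∈ = c-δ-P (c-P (p 3))

        Off-M : ∀ {e} → Off e → M π e ≡ true
        Off-M m₁∈ = mate∈M _ (c-P (p 1))
        Off-M m₂∈ = mate∈M _ (c-P (p 2))
        Off-M m₃∈ = mate∈M _ (c-P (p 3))

        On-M : ∀ {e} → On e → M π e ≡ false
        On-M l₂∈ = link∉M _
        On-M l₃∈ = link∉M _

      opaque
        c′ : V G → Bool
        c′ v = override (toD? v) (toP? v) (c v)

        c′-ToD : ∀ {v} → ToD v → c′ v ≡ false
        c′-ToD {v} = override-off (toD? v) (toP? v)

        c′-ToP : ∀ {v} → ToP v → c′ v ≡ true
        c′-ToP {v} q = override-on (toD? v) (toP? v) (λ d → true≢false (ToD-P d) (ToP-D q)) q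

        c′-P : ∀ {v} → c v ≡ true → ¬ ToD v → c′ v ≡ true
        c′-P {v} cv ¬d = override-true (toD? v) (toP? v) ¬d cv

        c′-D : ∀ {v} → c v ≡ false → ¬ ToP v → c′ v ≡ false
        c′-D {v} cv ¬q = override-false (toD? v) (toP? v) ¬q cv

        M′ : E G → Bool
        M′ e = override (off? e) (on? e) (M π e)

        M′-Off : ∀ {e} → Off e → M′ e ≡ false
        M′-Off {e} = override-off (off? e) (on? e)

        M′-On : ∀ {e} → On e → M′ e ≡ true
        M′-On {e} o = override-on (off? e) (on? e) (λ f → true≢false (Off-M f) (On-M o)) o

        M′-M : ∀ {e} → M π e ≡ true → ¬ Off e → M′ e ≡ true
        M′-M {e} m ¬o = override-true (off? e) (on? e) ¬o m

        M′-elim : ∀ {e} → M′ e ≡ true → On e ⊎ (M π e ≡ true × ¬ Off e)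
        M′-elim {e} = override-elim (off? e) (on? e)

      private
        ¬ToD : ∀ (x : Pv) → x ≢ p 1 → x ≢ p 2 → x ≢ μ (p 2) → x ≢ μ (p 3) → ¬ ToD (proj₁ x)
        ¬ToD x a b c d t = go t refl
          where
          go : ∀ {v} → ToD v → v ≡ proj₁ x → ⊥
          go P₁∈ eq = a (Pv-≡ (sym eq))
          go P₂∈ eq = b (Pv-≡ (sym eq))
          go Q₂∈ eq = c (Pv-≡ (sym eq))
          go Q₃∈ eq = d (Pv-≡ (sym eq))

        c′Q₁ : c′ Q₁ ≡ true
        c′Q₁ = c′-P (c-P (μ (p 1))) (¬ToD (μ (p 1)) (≢-sym (separate 1 1)) (≢-sym (separate 2 1))
          (≢-sym (Q≢ 1 1 p₁≢p₀)) (≢-sym (Q≢ 1 2 p₂≢p₀)))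

        c′P₃ : c′ P₃ ≡ true
        c′P₃ = c′-P (c-P (p 3)) (¬ToD (p 3) (P≢ 1 2 p₂≢p₀) (P≢ 2 1 p₁≢p₀) (separate 3 2) (separate 3 3))

        -- `δ P₁` loses its neighbour `P₁` and depends on this one. With only three blocks it would
        -- be `Q₃`, which moves to D; this is why the recolouring needs `p 3` to differ from `p 0`.
        c′Q₀ : c′ (proj₁ (μ (p 0))) ≡ true
        c′Q₀ = c′-P (c-P (μ (p 0))) (¬ToD (μ (p 0)) (≢-sym (separate 1 0)) (≢-sym (separate 2 0))
          (≢-sym (Q≢ 0 2 p₂≢p₀)) (≢-sym (Q≢ 0 3 p₃≢p₀)))

        -- The vertex of D after `Q₃` depends on `p 4`, which may well be `p 0`.
        c′P₄ : c′ (proj₁ (p 4)) ≡ true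
        c′P₄ = c′-P (c-P (p 4)) (¬ToD (p 4) (P≢ 1 3 p₃≢p₀) (P≢ 2 2 p₂≢p₀) (separate 4 2) (separate 4 3))

        Dominated : V G → Set
        Dominated v = ∃[ e ] ∃[ s ] (Any e × end e s ≡ v × c′ (end e (not s)) ≡ not (c′ v))

        viaMate : ∀ (x : Pv) {b} → c′ (proj₁ x) ≡ b → c′ (proj₁ (μ x)) ≡ not b → Dominated (proj₁ x)
        viaMate (v , cv) refl eq = mateEdge v cv , mateSide v cv , tt , mate-end v cv , trans (cong c′ (μ-mate v cv)) eq

        viaLink : ∀ {v b} → c′ v ≡ b → c′ (δ v) ≡ not b → Dominated v
        viaLink {v} refl eq = link v , linkSide v , tt , link-end v , eq

        fromLink : ∀ {v d b} → δ v ≡ d → c′ d ≡ b → c′ v ≡ not b → Dominated d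
        fromLink {v} refl refl eq = link v , not (linkSide v) , tt , refl
          , trans (cong c′ (trans (cong (end (link v)) (not-involutive _)) (link-end v))) eq

        viaMate′ : ∀ (x : Pv) {b} → c′ (proj₁ (μ x)) ≡ b → c′ (proj₁ x) ≡ not b → Dominated (proj₁ (μ x))
        viaMate′ x eq eq′ = viaMate (μ x) eq (trans (cong (c′ ∘ proj₁) (μ-involutive x)) eq′)

        δδ : ∀ {d} → c d ≡ false → δ (δ d) ≡ d
        δδ {d} cd = trans (δ-end (not (linkSide d)) (c-δ-D cd) (link∉M d))
          (trans (cong (end (link d)) (not-involutive _)) (link-end d))

        dom-P : ∀ v → c v ≡ true → ¬ ToD v → Dominated v
        dom-P v cv ¬d with v ≟ⱽ Q₁ | v ≟ⱽ P₃
        ... | yes refl | _ = viaMate′ (p 1) c′Q₁ (c′-ToD P₁∈)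
        ... | no _ | yes refl = viaMate (p 3) c′P₃ (c′-ToD Q₃∈)
        ... | no v≢Q₁ | no v≢P₃ = viaLink (c′-P cv ¬d) (c′-D (c-δ-P cv) (λ q → go q refl))
          where
          go : ∀ {d} → ToP d → δ v ≡ d → ⊥
          go D₂∈ eq with δ-injective (v , cv) (p 2) eq
          ... | inj₁ refl = ¬d P₂∈
          ... | inj₂ h = v≢Q₁ (cong proj₁ (trans h (σ-p 1)))
          go D₃∈ eq with δ-injective (v , cv) (p 3) eq
          ... | inj₁ refl = v≢P₃ refl
          ... | inj₂ h = ¬d (subst ToD (sym (cong proj₁ (trans h (σ-p 2)))) Q₂∈)

        dom-D : ∀ v → c v ≡ false → ¬ ToP v → Dominated v
        dom-D v cv ¬q with toD? (δ v)
        ... | no ¬d = viaLink (c′-D cv ¬q) (c′-P (c-δ-D cv) ¬d)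
        ... | yes d = go d (δδ cv)
          where
          go : ∀ {x} → ToD x → δ x ≡ v → Dominated v
          go P₁∈ eq = fromLink (trans (sym (δ-σ (μ (p 0)))) eq) (c′-D cv ¬q) c′Q₀
          go P₂∈ refl = contradiction D₂∈ ¬q
          go Q₂∈ eq = contradiction (subst ToP (trans (sym δQ₂) eq) D₃∈) ¬q
          go Q₃∈ eq = fromLink (trans (δ-σ (μ (p 3))) eq) (c′-D cv ¬q) c′P₄

        dom′ : ∀ v → Dominated v
        dom′ v with toD? v | toP? v
        ... | yes P₁∈ | _ = viaMate (p 1) (c′-ToD P₁∈) c′Q₁
        ... | yes P₂∈ | _ = viaLink (c′-ToD P₂∈) (c′-ToP D₂∈)
        ... | yes Q₂∈ | _ = viaLink (c′-ToD Q₂∈) (c′-ToP (subst ToP (sym δQ₂) D₃∈))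
        ... | yes Q₃∈ | _ = viaMate′ (p 3) (c′-ToD Q₃∈) c′P₃
        ... | no _ | yes D₂∈ = fromLink refl (c′-ToP D₂∈) (c′-ToD P₂∈)
        ... | no _ | yes D₃∈ = fromLink δQ₂ (c′-ToP D₃∈) (c′-ToD Q₂∈)
        ... | no ¬d | no ¬q with c v in cv
        ...   | true  = dom-P v cv ¬d
        ...   | false = dom-D v cv ¬q

        On-ends : ∀ {e} → On e → ∀ s → (end e s ≡ Q₁ × e ≡ lk (μ (p 1))) ⊎ (end e s ≡ P₃ × e ≡ lk (p 3))
          ⊎ (end e s ≡ D₂ × e ≡ lk (μ (p 1))) ⊎ (end e s ≡ D₃ × e ≡ lk (p 3))
        On-ends l₂∈ s with ≡-or-≡not (linkSide Q₁) s
        ... | inj₁ refl = inj₁ (link-end Q₁ , refl)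
        ... | inj₂ refl = inj₂ (inj₂ (inj₁ (δQ₁ , refl)))
        On-ends l₃∈ s with ≡-or-≡not (linkSide P₃) s
        ... | inj₁ refl = inj₂ (inj₁ (link-end P₃ , refl))
        ... | inj₂ refl = inj₂ (inj₂ (inj₂ (refl , refl)))

        kept-ends : ∀ {e} s → M π e ≡ true → ¬ Off e → ∀ i → (∀ {x} → x ≡ mt (p i) → Off x) →
          end e s ≢ proj₁ (p i) × end e s ≢ proj₁ (μ (p i))
        kept-ends s m ¬o i off = (λ eq → ¬o (off (sym (mt-unique (p i) s m eq))))
          , (λ eq → ¬o (off (trans (sym (mt-unique (μ (p i)) s m eq)) (mt-μ (p i)))))

        off₁ : ∀ {x} → x ≡ mt (p 1) → Off x
        off₁ refl = m₁∈
        off₂ : ∀ {x} → x ≡ mt (p 2) → Off x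
        off₂ refl = m₂∈
        off₃ : ∀ {x} → x ≡ mt (p 3) → Off x
        off₃ refl = m₃∈

        M-ends′ : ∀ {e} s → M′ e ≡ true → c′ (end e s) ≡ true
        M-ends′ {e} s m with M′-elim m
        ... | inj₁ o with On-ends o s
        ...   | inj₁ (eq , _) = trans (cong c′ eq) c′Q₁
        ...   | inj₂ (inj₁ (eq , _)) = trans (cong c′ eq) c′P₃
        ...   | inj₂ (inj₂ (inj₁ (eq , _))) = trans (cong c′ eq) (c′-ToP D₂∈)
        ...   | inj₂ (inj₂ (inj₂ (eq , _))) = trans (cong c′ eq) (c′-ToP D₃∈)
        M-ends′ {e} s m | inj₂ (me , ¬o) = c′-P (M-ends π s me) (¬ToD (end e s , M-ends π s me)
          (proj₁ (kept-ends s me ¬o 1 off₁) ∘ cong proj₁) (proj₁ (kept-ends s me ¬o 2 off₂) ∘ cong proj₁)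
          (proj₂ (kept-ends s me ¬o 2 off₂) ∘ cong proj₁) (proj₂ (kept-ends s me ¬o 3 off₃) ∘ cong proj₁))

        Mated : V G → Set
        Mated v = ∃[ e ] ∃[ s ] (M′ e ≡ true × end e s ≡ v)

        mate′ : ∀ v → c′ v ≡ true → Mated v
        mate′ v c′v with toP? v
        ... | yes D₂∈ = lk (μ (p 1)) , not (linkSide Q₁) , M′-On l₂∈ , δQ₁
        ... | yes D₃∈ = lk (p 3) , not (linkSide P₃) , M′-On l₃∈ , refl
        ... | no ¬q with c v in cv
        ...   | false = contradiction (c′-D cv ¬q) (true≢false c′v)
        ...   | true with v ≟ⱽ Q₁ | v ≟ⱽ P₃
        ...     | yes refl | _ = lk (μ (p 1)) , linkSide Q₁ , M′-On l₂∈ , link-end Q₁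
        ...     | no _ | yes refl = lk (p 3) , linkSide P₃ , M′-On l₃∈ , link-end P₃
        ...     | no v≢Q₁ | no v≢P₃ = mateEdge v cv , mateSide v cv , M′-M (mate∈M v cv) (λ o → go o refl) , mate-end v cv
          where
          notD : ∀ {x} → ToD x → v ≢ x
          notD d refl = true≢false c′v (c′-ToD d)
          go : ∀ {x} → Off x → mt (v , cv) ≡ x → ⊥
          go m₁∈ eq = [ notD P₁∈ ∘ cong proj₁ , v≢Q₁ ∘ cong proj₁ ]′ (mt-injective (v , cv) (p 1) eq)
          go m₂∈ eq = [ notD P₂∈ ∘ cong proj₁ , notD Q₂∈ ∘ cong proj₁ ]′ (mt-injective (v , cv) (p 2) eq)
          go m₃∈ eq = [ v≢P₃ ∘ cong proj₁ , notD Q₃∈ ∘ cong proj₁ ]′ (mt-injective (v , cv) (p 3) eq)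

        On-kept : ∀ {e s x t} → On e → M π x ≡ true → ¬ Off x → end e s ≢ end x t
        On-kept {e} {s} {x} {t} o m ¬o eq with On-ends o s
        ... | inj₁ (h , _) = proj₂ (kept-ends t m ¬o 1 off₁) (trans (sym eq) h)
        ... | inj₂ (inj₁ (h , _)) = proj₁ (kept-ends t m ¬o 3 off₃) (trans (sym eq) h)
        ... | inj₂ (inj₂ (inj₁ (h , _))) = true≢false (M-ends π t m) (trans (cong c (trans (sym eq) h)) (ToP-D D₂∈))
        ... | inj₂ (inj₂ (inj₂ (h , _))) = true≢false (M-ends π t m) (trans (cong c (trans (sym eq) h)) (ToP-D D₃∈))

        l₂-l₃ : ∀ s t → end (lk (μ (p 1))) s ≢ end (lk (p 3)) t
        l₂-l₃ s t eq with ≡-or-≡not (linkSide Q₁) s | ≡-or-≡not (linkSide P₃) t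
        ... | inj₁ refl | inj₁ refl = separate 3 1 (Pv-≡ (trans (sym (link-end P₃)) (trans (sym eq) (link-end Q₁))))
        ... | inj₁ refl | inj₂ refl = true≢false (trans (cong c (link-end Q₁)) (c-P (μ (p 1)))) (trans (cong c eq) (ToP-D D₃∈))
        ... | inj₂ refl | inj₁ refl = true≢false (trans (cong c (link-end P₃)) (c-P (p 3))) (trans (cong c (trans (sym eq) δQ₁)) (ToP-D D₂∈))
        ... | inj₂ refl | inj₂ refl with δ-injective (p 3) (p 2) (sym (trans (sym δQ₁) eq))
        ...   | inj₁ h = P≢ 2 1 p₁≢p₀ h
        ...   | inj₂ h = separate 3 1 (trans h (σ-p 1))

        mate-unique′ : ∀ {e s x t} → M′ e ≡ true → M′ x ≡ true → end e s ≡ end x t → e ≡ x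
        mate-unique′ {e} {s} {x} {t} m m′ eq with M′-elim m | M′-elim m′
        ... | inj₂ (me , _) | inj₂ (mx , _) = mate-unique π {s = s} {s′ = t} me mx eq
        ... | inj₁ o | inj₂ (mx , ¬o) = ⊥-elim (On-kept {s = s} {t = t} o mx ¬o eq)
        ... | inj₂ (me , ¬o) | inj₁ o = ⊥-elim (On-kept {s = t} {t = s} o me ¬o (sym eq))
        ... | inj₁ l₂∈ | inj₁ l₂∈ = refl
        ... | inj₁ l₃∈ | inj₁ l₃∈ = refl
        ... | inj₁ l₂∈ | inj₁ l₃∈ = ⊥-elim (l₂-l₃ s t eq)
        ... | inj₁ l₃∈ | inj₁ l₂∈ = ⊥-elim (l₂-l₃ t s (sym eq))

      recoloured : Pair G Any
      recoloured = record
        { colour = c′ ; M = M′ ; dominated = dom′ ; M⊆F = λ _ → tt ; M-ends = M-ends′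
        ; M-loopless = λ _ → loopless _ ; mate = mate′
        ; mate-unique = λ {e} {s} {e′} {s′} → mate-unique′ {e} {s} {e′} {s′} }

      -- The dropped edge `mt (p 2)` joins `P₂` to `Q₂`, both now in D, against `crossing` for the
      -- recoloured pair.
      absurd : ⊥
      absurd = ≡not⇒≢ (c′ P₂) (trans (c′-ToD P₂∈) (trans (sym (c′-ToD Q₂∈))
        (trans (cong c′ (sym (μ-mate P₂ (c-P (p 2))))) (trans (R.crossing (mateSide P₂ _) (M′-Off m₂∈)) (cong (not ∘ c′) (mate-end P₂ (c-P (p 2))))))))
        where module R = Structure G crit recoloured

  2-regular⇒cycle : Connected G → cycle 3 ≅ G ⊎ cycle 6 ≅ G ⊎ cycle 9 ≅ G
  2-regular⇒cycle conn = search (p 1 ≟ᴾ p 0) (p 2 ≟ᴾ p 0) (p 3 ≟ᴾ p 0)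
    where
    start : Pv
    start with card⇒inhabited (V-finite G) (proj₁ conn)
    ... | v with c v in cv
    ...   | true  = v , cv
    ...   | false = δ v , c-δ-D cv
    open Walk start

    _≟ᴾ_ : (x y : Pv) → Dec (x ≡ y)
    x ≟ᴾ y = map′ Pv-≡ (cong proj₁) (proj₁ x ≟ⱽ proj₁ y)

    search : Dec (p 1 ≡ p 0) → Dec (p 2 ≡ p 0) → Dec (p 3 ≡ p 0) → cycle 3 ≅ G ⊎ cycle 6 ≅ G ⊎ cycle 9 ≅ G
    search (yes eq₁) _ _ = inj₁ (cycle≅ conn λ { 0F → joins₀ conn 0 ; 1F → joins₁ conn 0 ; 2F → joinsLast conn })
      where
      min : ∀ t → 0 < t → t < 1 → p t ≢ p 0
      min (suc _) _ (s≤s ())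
      open Closed 0 eq₁ min
    search (no ne₁) (yes eq₂) _ = inj₂ (inj₁ (cycle≅ conn
      λ { 0F → joins₀ conn 0 ; 1F → joins₁ conn 0 ; 2F → joins₂ conn 0
        ; 3F → joins₀ conn 1 ; 4F → joins₁ conn 1 ; 5F → joinsLast conn }))
      where
      min : ∀ t → 0 < t → t < 2 → p t ≢ p 0
      min 1             _ _ = ne₁
      min (suc (suc _)) _ (s≤s (s≤s ()))
      open Closed 1 eq₂ min
    search (no ne₁) (no ne₂) (yes eq₃) = inj₂ (inj₂ (cycle≅ conn
      λ { 0F → joins₀ conn 0 ; 1F → joins₁ conn 0 ; 2F → joins₂ conn 0
        ; 3F → joins₀ conn 1 ; 4F → joins₁ conn 1 ; 5F → joins₂ conn 1
        ; 6F → joins₀ conn 2 ; 7F → joins₁ conn 2 ; 8F → joinsLast conn }))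
      where
      min : ∀ t → 0 < t → t < 3 → p t ≢ p 0
      min 1                   _ _ = ne₁
      min 2                   _ _ = ne₂
      min (suc (suc (suc _))) _ (s≤s (s≤s (s≤s ())))
      open Closed 2 eq₃ min
    search (no ne₁) (no ne₂) (no ne₃) = ⊥-elim (Long.absurd ne₁ ne₂ ne₃)

-- The two directions of the characterisation

unique-or-cycle : (G : Graph) → Critical G → Connected G → (π : Pair G Any) →
  (∀ D P → IsDPPair G D P → D ≗ not ∘ colour π × P ≗ colour π)
  ⊎ (cycle 3 ≅ G ⊎ cycle 6 ≅ G ⊎ cycle 9 ≅ G)
-- The split is on 2-regularity, which a finite search decides, and not on uniqueness, which ranges
-- over all pairs. A second pair would force 2-regularity, so its failure gives uniqueness.
unique-or-cycle G crit conn π with all? (V-finite G) (twoEdges? G)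
... | yes two = inj₂ (Regular.2-regular⇒cycle G crit π two conn)
... | no ¬two = inj₁ λ D P dp → (λ v → trans (D≗not-P dp v) (cong not (same dp v))) , same dp
  where
  same : ∀ {D P} → IsDPPair G D P → P ≗ colour π
  same dp v with DPPair⇒Pair dp
  ... | π′ , refl = decidable-stable (_ Bool.≟ _) (λ ne → ¬two (differ⇒2-regular G crit π′ π conn ne))

Vᵒ≗not-Vⁿ : ∀ H α → Vᵒ H α ≗ not ∘ Vⁿ H α
Vᵒ≗not-Vⁿ H α (2-Subdivision.old _)   = refl
Vᵒ≗not-Vⁿ H α (2-Subdivision.new _ _) = refl

OnlyCanonicalOrCycle : (H : Graph) → (LeafSet H → ℕ) → Set
OnlyCanonicalOrCycle H α = IsOnlyDPPair (S₂ H α) (Vᵒ H α) (Vⁿ H α)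
  ⊎ (S₂ H α ≅ cycle 3 ⊎ S₂ H α ≅ cycle 6 ⊎ S₂ H α ≅ cycle 9)

module _ (H : Graph) (α : LeafSet H → ℕ) (noIso : NoIsolatedVertex H) (α≥1 : ∀ l → 1 ≤ α l) where

  Critical⇒OnlyCanonicalOrCycle : Connected (S₂ H α) → Critical (S₂ H α) → OnlyCanonicalOrCycle H α
  Critical⇒OnlyCanonicalOrCycle conn crit = convert (unique-or-cycle (S₂ H α) crit conn π₀)
    where
    π₀ : Pair (S₂ H α) Any
    π₀ = canonicalPair H α noIso α≥1

    convert : (∀ D P → IsDPPair (S₂ H α) D P → D ≗ not ∘ Vⁿ H α × P ≗ Vⁿ H α)
      ⊎ (cycle 3 ≅ S₂ H α ⊎ cycle 6 ≅ S₂ H α ⊎ cycle 9 ≅ S₂ H α) → OnlyCanonicalOrCycle H α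
    convert (inj₁ only) = inj₁ (Pair⇒DPPair π₀ (Vᵒ≗not-Vⁿ H α) (λ _ → refl)
      , λ D P dp → (λ v → trans (proj₁ (only D P dp) v) (sym (Vᵒ≗not-Vⁿ H α v))) , proj₂ (only D P dp))
    convert (inj₂ (inj₁ i))        = inj₂ (inj₁ (≅-sym i))
    convert (inj₂ (inj₂ (inj₁ i))) = inj₂ (inj₂ (inj₁ (≅-sym i)))
    convert (inj₂ (inj₂ (inj₂ i))) = inj₂ (inj₂ (inj₂ (≅-sym i)))

  OnlyCanonicalOrCycle⇒Critical : OnlyCanonicalOrCycle H α → Critical (S₂ H α)
  OnlyCanonicalOrCycle⇒Critical (inj₁ (_ , only))      = only-canonical⇒Critical H α noIso α≥1 only
  OnlyCanonicalOrCycle⇒Critical (inj₂ (inj₁ i))        = transport-Critical (≅-sym i) cycle3-Critical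
  OnlyCanonicalOrCycle⇒Critical (inj₂ (inj₂ (inj₁ i))) = transport-Critical (≅-sym i) cycle6-Critical
  OnlyCanonicalOrCycle⇒Critical (inj₂ (inj₂ (inj₂ i))) = transport-Critical (≅-sym i) cycle9-Critical

is-2-subdivision : (G : Graph) → Critical G → Pair G Any → Connected G →
  Σ[ H ∈ Graph ] Σ[ α ∈ (LeafSet H → ℕ) ]
    (Connected H × NoIsolatedVertex H × (∀ l → 1 ≤ α l) × G ≅ S₂ H α)
is-2-subdivision G crit π conn = H , α , connected conn , noIsolated , α-pos , ≅-sym S₂≅G
  where open Contraction G crit π

theorem6p1 : (G : Graph) → Connected G → 3 ≤ order G →
    IsMinimalDPDP G
    ⇔ (Σ[ H ∈ Graph ] Σ[ α ∈ (LeafSet H → ℕ) ]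
    (Connected H × NoIsolatedVertex H × (∀ l → 1 ≤ α l)
    × G ≅ S₂ H α
    × (IsOnlyDPPair (S₂ H α) (Vᵒ H α) (Vⁿ H α)
    ⊎ (S₂ H α ≅ cycle 3 ⊎ S₂ H α ≅ cycle 6 ⊎ S₂ H α ≅ cycle 9))))
theorem6p1 G conn _ = mk⇔ forward backward
  where
  Characterised : Set₁
  Characterised = Σ[ H ∈ Graph ] Σ[ α ∈ (LeafSet H → ℕ) ]
    (Connected H × NoIsolatedVertex H × (∀ l → 1 ≤ α l) × G ≅ S₂ H α × OnlyCanonicalOrCycle H α)

  choose : Critical G → (Σ[ H ∈ Graph ] Σ[ α ∈ (LeafSet H → ℕ) ]
    (Connected H × NoIsolatedVertex H × (∀ l → 1 ≤ α l) × G ≅ S₂ H α)) → Characterised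
  choose crit (H , α , connH , noIso , α≥1 , iso) = H , α , connH , noIso , α≥1 , iso
    -- The alternative is settled inside `S₂ H α`, where the pair to compare with is the canonical
    -- one, so connectedness and criticality are carried over first.
    , Critical⇒OnlyCanonicalOrCycle H α noIso α≥1 (transport-Connected iso conn) (transport-Critical iso crit)

  forward : IsMinimalDPDP G → Characterised
  forward min = choose crit (is-2-subdivision G crit (IsDPDP⇒Pair (proj₁ min)) conn)
    where crit = proj₂ (Equivalence.to IsMinimalDPDP⇔Critical min)

  backward : Characterised → IsMinimalDPDP G
  backward (H , α , _ , noIso , α≥1 , iso , alternatives) =
    Equivalence.from IsMinimalDPDP⇔Critical
      ( Pair⇒IsDPDP (transport-Pair (≅-sym iso) (const tt) (canonicalPair H α noIso α≥1))
      , transport-Critical (≅-sym iso) (OnlyCanonicalOrCycle⇒Critical H α noIso α≥1 alternatives))
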